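{- For $n\in\mathbb{N}$ put $E_n(X):=e^{nX}$ and $L_n(X):=\dfrac{e^{X}q^{n}}{1-e^{X}q^{n}}\in\mathbb{Q}[[q,X]]$. For every $l\ge 1$ the generating series of bi-brackets (defined in the context) satisfies \[ T\binom{X_1,\dots,X_l}{Y_1,\dots,Y_l}=\sum_{u_1>\dots>u_l>0}\prod_{j=1}^{l}E_{u_j}(Y_j)\,L_{u_j}(X_j) =\sum_{u_1>\dots>u_l>0}\prod_{j=1}^{l}E_{u_j}(X_{l+1-j}-X_{l+2-j})\,L_{u_j}(Y_1+\dots+Y_{l-j+1}), \] where $X_{l+1}:=0$. In particular the partition relation holds: \[ T\binom{X_1,\dots,X_l}{Y_1,\dots,Y_l}=T\binom{Y_1+\dots+Y_l,\ \dots,\ Y_1+Y_2,\ Y_1}{X_l,\ X_{l-1}-X_l,\ \dots,\ X_1-X_2}. \]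
   Context: For integers $s_1,\dots,s_l\ge1$ and $r_1,\dots,r_l\ge0$ the bi-bracket is the $q$-series \[ \binom{s_1,\dots,s_l}{r_1,\dots,r_l}:=\sum_{\substack{u_1>\dots>u_l>0\\ v_1,\dots,v_l>0}}\prod_{j=1}^{l}\frac{u_j^{r_j}}{r_j!}\,\frac{v_j^{s_j-1}}{(s_j-1)!}\;q^{u_1v_1+\dots+u_lv_l}\in\mathbb{Q}[[q]]. \] Its generating series is \[ T\binom{X_1,\dots,X_l}{Y_1,\dots,Y_l}:=\sum_{\substack{s_1,\dots,s_l>0\\ r_1,\dots,r_l>0}}\binom{s_1,\dots,s_l}{r_1-1,\dots,r_l-1}X_1^{s_1-1}\cdots X_l^{s_l-1}\,Y_1^{r_1-1}\cdots Y_l^{r_l-1}, \] a formal power series in $X_1,\dots,X_l,Y_1,\dots,Y_l$ with coefficients in $\mathbb{Q}[[q]]$. All identities are identities of formal power series in $q$ and the variables. -}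

module Defs where

open import Data.Nat as ℕ using (ℕ; zero; suc; _∸_; _<_; _>_; _!)
import Data.Nat.Properties as ℕₚ
open import Data.Integer using (+_)
open import Data.Rational using (ℚ; 0ℚ; 1ℚ; _/_; _+_; _*_; -_)
open import Data.Bool using (if_then_else_)
open import Data.Fin using (Fin; zero; suc; _↑ˡ_; _↑ʳ_; opposite)
open import Data.List as List using (List; []; _∷_; upTo; cartesianProduct; cartesianProductWith; filter)
open import Data.List.Membership.Propositional using (_∉_)
open import Data.List.Relation.Unary.Unique.Propositional using (Unique)
import Data.List.Relation.Unary.All as Listᴬ
open import Data.Vec as Vec using (Vec; []; _∷_; lookup; _[_]≔_)
open import Data.Vec.Properties using (≡-dec)
open import Data.Vec.Relation.Unary.All using (All; all?)
open import Data.Vec.Relation.Unary.Linked using (Linked; linked?)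
open import Data.Vec.Functional as F using (Vector)
open import Data.Product using (Σ-syntax; _×_; _,_)
open import Function using (_∘_)
open import Relation.Nullary using (Dec; does)
open import Relation.Nullary.Decidable using (_×-dec_)
open import Relation.Binary.PropositionalEquality using (_≡_)

private
  variable
    l m n : ℕ

sumℚ productℚ : List ℚ → ℚ
sumℚ     = List.foldr _+_ 0ℚ
productℚ = List.foldr _*_ 1ℚ

-- x ^ k / k!
dividedPower : ℕ → ℕ → ℚ
dividedPower x k = (+ (x ℕ.^ k)) / (k !)
  where instance _ = k ℕₚ.!≢0

-- All m-tuples with entries in {0, …, N}.
box : (m N : ℕ) → List (Vec ℕ m)
box zero    N = [] ∷ []
box (suc m) N = cartesianProductWith _∷_ (upTo (suc N)) (box m N)

------------------------------------------------------------------------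
-- ℚ[[z₁, …, zₘ]], a series being its function of coefficients

PS : ℕ → Set
PS m = Vec ℕ m → ℚ

infix  4 _≈_
infixl 6 _⊕_ _⊖_
infixl 7 _⊗_
infixr 7 _•_
infixr 8 _↑_

_≈_ : PS m → PS m → Set
f ≈ g = ∀ α → f α ≡ g α

monomial : Vec ℕ m → PS m
monomial α β = if does (≡-dec ℕ._≟_ α β) then 1ℚ else 0ℚ

0ₛ 1ₛ : PS m
0ₛ _ = 0ℚ
1ₛ   = monomial (Vec.replicate _ 0)

var : Fin m → PS m
var i = monomial (Vec.replicate _ 0 [ i ]≔ 1)

_⊕_ _⊖_ _⊗_ : PS m → PS m → PS m
(f ⊕ g) α = f α + g α
(f ⊖ g) α = f α + (- g α)

-- All (β , γ) with β + γ = α.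
splittings : Vec ℕ m → List (Vec ℕ m × Vec ℕ m)
splittings []      = ([] , []) ∷ []
splittings (k ∷ α) =
  cartesianProductWith (λ i (β , γ) → (i ∷ β) , (k ∸ i ∷ γ)) (upTo (suc k)) (splittings α)

(f ⊗ g) α = sumℚ (List.map (λ (β , γ) → f β * g γ) (splittings α))

_•_ : ℕ → PS m → PS m
(k • f) α = (+ k / 1) * f α

_↑_ : PS m → ℕ → PS m
f ↑ zero  = 1ₛ
f ↑ suc k = f ⊗ f ↑ k

∏ : Vector (PS m) l → PS m
∏ = F.foldr _⊗_ 1ₛ

-- Substitution  f(g₁, …, gₘ) = Σ_α f_α g₁^α₁ ⋯ gₘ^αₘ,  meaningful when every
-- gᵢ has zero constant term.  Then g₁^α₁ ⋯ gₘ^αₘ has no terms of total degree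
-- below α₁ + … + αₘ, so for the coefficient at β only exponents αᵢ ≤ |β| matter.
_⟦_⟧ : PS m → Vector (PS n) m → PS n
_⟦_⟧ {m = m} f g β =
  sumℚ (List.map (λ α → f α * ∏ (λ i → g i ↑ lookup α i) β) (box m (Vec.sum β)))

-- For f with zero constant term.
exp : PS m → PS m
exp f = (λ α → dividedPower 1 (Vec.head α)) ⟦ f F.∷ F.[] ⟧

-- For f with constant term 1: the geometric series in 1 - f.
inverse : PS m → PS m
inverse f = (λ (_ : Vec ℕ 1) → 1ℚ) ⟦ 1ₛ ⊖ f F.∷ F.[] ⟧

-- s is the sum of the (possibly infinite) family of the f i with P i: for each
-- monomial only finitely many members have a nonzero coefficient, and these
-- coefficients add up to that of s.
IsSum : {I : Set} → (I → Set) → (I → PS m) → PS m → Set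
IsSum {I = I} P f s = ∀ α → Σ[ S ∈ List I ]
  Unique S × Listᴬ.All P S
  × (∀ i → P i → i ∉ S → f i α ≡ 0ℚ)
  × sumℚ (List.map (λ i → f i α) S) ≡ s α

------------------------------------------------------------------------
-- Bi-brackets

-- u₁ > … > uₗ > 0
Decreasing⁺ : Vec ℕ l → Set
Decreasing⁺ u = Linked _>_ u × All (0 <_) u

decreasing⁺? : (u : Vec ℕ l) → Dec (Decreasing⁺ u)
decreasing⁺? u = linked? ℕₚ._>?_ u ×-dec all? (0 ℕₚ.<?_) u

_∙_ : Vec ℕ l → Vec ℕ l → ℕ
u ∙ v = Vec.sum (Vec.zipWith ℕ._*_ u v)

-- The (u , v) contributing to q^N; u ∙ v = N with positive entries forces all
-- entries to be at most N.
biIndices : (l N : ℕ) → List (Vec ℕ l × Vec ℕ l)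
biIndices l N =
  filter (λ (u , v) → decreasing⁺? u ×-dec (all? (0 ℕₚ.<?_) v ×-dec (u ∙ v ℕ.≟ N)))
         (cartesianProduct (box l N) (box l N))

-- The bi-bracket with upper row s (entries ≥ 1) and lower row r, in ℚ[[q]].
biBracket : (s r : Vec ℕ l) → PS 1
biBracket {l} s r (N ∷ []) = sumℚ (List.map term (biIndices l N))
  where
  term : Vec ℕ l × Vec ℕ l → ℚ
  term (u , v) = productℚ (List.map factor (List.allFin l))
    where
    factor : Fin l → ℚ
    factor j = dividedPower (lookup u j) (lookup r j)
             * dividedPower (lookup v j) (lookup s j ∸ 1)

------------------------------------------------------------------------
-- ℚ[[q, X₁, …, Xₗ, Y₁, …, Yₗ]]

Series : ℕ → Set
Series l = PS (suc (l ℕ.+ l))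

q : PS (suc m)
q = var zero

X Y : Vector (Series l) l
X {l} j = var (suc (j ↑ˡ l))
Y {l} j = var (suc (l ↑ʳ j))

T : (l : ℕ) → Series l
T l (N ∷ ab) = biBracket (Vec.map suc (Vec.take l ab)) (Vec.drop l ab) (N ∷ [])

-- T with (X₁, …, Xₗ) and (Y₁, …, Yₗ) replaced by A and B.
T⟨_,_⟩ : (A B : Vector (Series l) l) → Series l
T⟨_,_⟩ {l} A B = T l ⟦ q F.∷ (A F.++ B) ⟧

-- E k f and L k f are E_k and L_k evaluated at a series f with zero constant
-- term; L k f is meaningful for k ≥ 1.
E : ℕ → PS m → PS m
E k f = exp (k • f)

L : ℕ → PS (suc m) → PS (suc m)
L k f = (exp f ⊗ q ↑ k) ⊗ inverse (1ₛ ⊖ exp f ⊗ q ↑ k)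

snoc : {A : Set} → Vector A n → A → Vector A (suc n)
snoc {zero}  f a _       = a
snoc {suc n} f a zero    = f zero
snoc {suc n} f a (suc i) = snoc (f ∘ suc) a i

-- X₁, …, Xₗ, Xₗ₊₁ with Xₗ₊₁ = 0
X⁺ : Vector (Series l) (suc l)
X⁺ = snoc X 0ₛ

-- f₁ + … + fᵢ
partialSum : Vector (PS m) n → Fin n → PS m
partialSum f zero    = f zero
partialSum f (suc i) = f zero ⊕ partialSum (f ∘ suc) i

-- With 1-based j, opposite j is l + 1 - j; hence the entries below are
-- X_{l+1-j} - X_{l+2-j}  and  Y₁ + … + Y_{l+1-j}.
X′ Y′ : Vector (Series l) l
X′ j = X (opposite j) ⊖ X⁺ (suc (opposite j))
Y′ j = partialSum Y (opposite j)

{-# OPTIONS --safe #-}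

-- The (u , v) term of T⟨A , B⟩ is W(u , v) = q^(u·v) exp(Σ uⱼ Bⱼ) exp(Σ vⱼ Aⱼ).  Expanding
-- each L as a geometric series and using exp(f + g) = exp f exp g, the product of the
-- E(Bⱼ) L(Aⱼ) at u is the sum of the W(u , v) over all positive v.  For the partition
-- relation write u as the suffix sums of positive differences d; conjugation of the partition
-- with parts uⱼ of multiplicities vⱼ turns (d , v) into (reverse v , reverse d), and summation
-- by parts shows that it carries the W of (X , Y) to the W of (Y′ , X′).  Every infinite sum
-- becomes finite modulo terms of total degree > M, since W(u , v) is divisible by q^(u·v).

module Submission where

open import Algebra using (CommutativeRing; CommutativeSemiring)
import Algebra.Properties.CommutativeMonoid.Mult as MonoidMult
import Algebra.Properties.Semiring.Mult as SemiringMult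
import Algebra.Solver.Ring.NaturalCoefficients.Default as NatSolver
open import Algebra.Structures using (IsCommutativeMonoid; IsCommutativeSemiring)
open import Algebra.Structures.Biased using (isCommutativeSemiringˡ)
open import Data.List as List using (List; []; _∷_; _++_; upTo; cartesianProduct; cartesianProductWith; concat; filter)
import Data.List.Properties as Listₚ
open import Data.List.Membership.Propositional using (_∈_; _∉_)
open import Data.List.Membership.Propositional.Properties
  using ( ∈-++⁺ʳ; ∈-∃++; ∈-cartesianProduct⁺; ∈-cartesianProduct⁻; ∈-cartesianProductWith⁺; ∈-cartesianProductWith⁻
        ; ∈-concat⁺′; ∈-concat⁻′; ∈-filter⁺; ∈-filter⁻; ∈-map⁺; ∈-map⁻; ∈-upTo⁺; ∈-upTo⁻ )
open import Data.List.Relation.Binary.Disjoint.Propositional using (Disjoint)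
import Data.List.Relation.Unary.All as Listᴬ
import Data.List.Relation.Unary.All.Properties as Listᴬₚ
open import Data.List.Relation.Unary.AllPairs as AllPairs using ([]; _∷_)
import Data.List.Relation.Unary.AllPairs.Properties as AllPairsₚ
open import Data.List.Relation.Unary.Any using (here; there)
open import Data.List.Relation.Unary.Unique.Propositional using (Unique)
import Data.List.Relation.Unary.Unique.Propositional.Properties as Uniqueₚ
open import Data.Nat as ℕ using (ℕ; zero; suc; _∸_; _≤_; _<_; _≥_; z≤n; s≤s; NonZero; _!)
import Data.Nat.Properties as ℕₚ
import Data.Nat.Tactic.RingSolver as ℕSolver
open import Data.Product using (_×_; _,_; proj₁; proj₂; ∃-syntax)
import Data.Product.Properties as Productₚ
open import Data.Sum using (inj₁; inj₂)
open import Data.Vec as Vec using (Vec; []; _∷_; lookup; _[_]≔_; _∷ʳ_; reverse)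
import Data.Vec.Properties as Vecₚ
open import Data.Vec.Functional as F using (Vector)
import Data.Vec.Functional.Properties as Fₚ
open import Data.Vec.Relation.Unary.All using (All; []; _∷_; all?)
import Data.Vec.Relation.Unary.All.Properties as Vecᴬₚ
open import Data.Vec.Relation.Unary.Linked using ([]; [-]; _∷_)
open import Function using (_∘_; id)
open import Level using (0ℓ)
open import Relation.Binary.Definitions using (DecidableEquality)
open import Relation.Binary.PropositionalEquality as ≡ using (_≡_; _≢_; module ≡-Reasoning)
open import Relation.Binary.Structures using (IsEquivalence)
open import Relation.Nullary using (yes; no; contradiction)
open import Relation.Nullary.Decidable using (_×-dec_)

-- The obstacle is that substitution, `exp` and `inverse` are given coefficient by coefficient, with
-- a summation range that grows with the coefficient, so none of them is a finite expression in
-- series. Once a bound M on the total degree is fixed, these ranges may all be replaced by 0, ...,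
-- M, and equality up to degree M again gives a commutative semiring with the same operations.
-- Finite sums and Cauchy products are therefore treated over an arbitrary commutative semiring:
-- over exact series they yield the semiring laws by induction on the number of variables, over
-- truncated series they carry the identities for exponentials and geometric series. M is chosen
-- only at the end, as the total degree of the coefficient in question. The logical order differs
-- from that of the theorem. Both sums over u are instances of one expansion of T⟨A , B⟩, valid for
-- all A and B without constant terms. The partition relation is proved by conjugation, and it then
-- turns the second instance into a formula for T.

private variable
  l m n : ℕ

-- Finite sums and Cauchy products over a commutative semiring

module FiniteSum (R : CommutativeSemiring 0ℓ 0ℓ) where
  open CommutativeSemiring R
  open import Relation.Binary.Reasoning.Setoid setoid
  open import Data.List.Membership.DecPropositional using (_∈?_)
  open NatSolver R using (solve; _:=_; _:+_)

  private variable
    A B C : Set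

  Σ : (A → Carrier) → List A → Carrier
  Σ f xs = List.foldr _+_ 0# (List.map f xs)

  Σ-cong∈ : ∀ {f g : A → Carrier} xs → (∀ {x} → x ∈ xs → f x ≈ g x) → Σ f xs ≈ Σ g xs
  Σ-cong∈ []       f≈g = refl
  Σ-cong∈ (x ∷ xs) f≈g = +-cong (f≈g (here ≡.refl)) (Σ-cong∈ xs (f≈g ∘ there))

  Σ-cong : ∀ {f g : A → Carrier} xs → (∀ x → f x ≈ g x) → Σ f xs ≈ Σ g xs
  Σ-cong xs f≈g = Σ-cong∈ xs (λ {x} _ → f≈g x)

  Σ-zero∈ : ∀ {f : A → Carrier} xs → (∀ {x} → x ∈ xs → f x ≈ 0#) → Σ f xs ≈ 0#
  Σ-zero∈ []       f≈0 = refl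
  Σ-zero∈ (x ∷ xs) f≈0 = trans (+-cong (f≈0 (here ≡.refl)) (Σ-zero∈ xs (f≈0 ∘ there))) (+-identityˡ 0#)

  Σ-+ : ∀ (f g : A → Carrier) xs → Σ (λ x → f x + g x) xs ≈ Σ f xs + Σ g xs
  Σ-+ f g []       = sym (+-identityˡ 0#)
  Σ-+ f g (x ∷ xs) = begin
    (f x + g x) + Σ (λ x → f x + g x) xs ≈⟨ +-congˡ (Σ-+ f g xs) ⟩
    (f x + g x) + (Σ f xs + Σ g xs)
      ≈⟨ solve 4 (λ a b c d → (a :+ b) :+ (c :+ d) := (a :+ c) :+ (b :+ d)) refl (f x) (g x) _ _ ⟩
    (f x + Σ f xs) + (g x + Σ g xs)      ∎

  *-Σ : ∀ c (f : A → Carrier) xs → c * Σ f xs ≈ Σ (λ x → c * f x) xs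
  *-Σ c f []       = zeroʳ c
  *-Σ c f (x ∷ xs) = trans (distribˡ c (f x) _) (+-congˡ (*-Σ c f xs))

  Σ-* : ∀ c (f : A → Carrier) xs → Σ f xs * c ≈ Σ (λ x → f x * c) xs
  Σ-* c f []       = zeroˡ c
  Σ-* c f (x ∷ xs) = trans (distribʳ c (f x) _) (+-congˡ (Σ-* c f xs))

  Σ-*-Σ : ∀ (f : A → Carrier) (g : B → Carrier) xs ys →
          Σ f xs * Σ g ys ≈ Σ (λ x → Σ (λ y → f x * g y) ys) xs
  Σ-*-Σ f g xs ys = trans (Σ-* _ f xs) (Σ-cong xs (λ x → *-Σ (f x) g ys))

  Σ-swap : ∀ (f : A → B → Carrier) xs ys →
           Σ (λ x → Σ (f x) ys) xs ≈ Σ (λ y → Σ (λ x → f x y) xs) ys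
  Σ-swap f []       ys = sym (Σ-zero∈ ys (λ _ → refl))
  Σ-swap f (x ∷ xs) ys = begin
    Σ (f x) ys + Σ (λ x → Σ (f x) ys) xs           ≈⟨ +-congˡ (Σ-swap f xs ys) ⟩
    Σ (f x) ys + Σ (λ y → Σ (λ x → f x y) xs) ys   ≈⟨ Σ-+ (f x) _ ys ⟨
    Σ (λ y → f x y + Σ (λ x → f x y) xs) ys        ∎

  Σ-map : ∀ (f : B → Carrier) (g : A → B) xs → Σ f (List.map g xs) ≡ Σ (f ∘ g) xs
  Σ-map f g xs = ≡.cong (List.foldr _+_ 0#) (≡.sym (Listₚ.map-∘ xs))

  Σ-++ : ∀ (f : A → Carrier) xs ys → Σ f (xs ++ ys) ≈ Σ f xs + Σ f ys
  Σ-++ f []       ys = sym (+-identityˡ _)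
  Σ-++ f (x ∷ xs) ys = trans (+-congˡ (Σ-++ f xs ys)) (sym (+-assoc _ _ _))

  Σ-concat : ∀ (f : A → Carrier) xss → Σ f (concat xss) ≈ Σ (Σ f) xss
  Σ-concat f []         = refl
  Σ-concat f (xs ∷ xss) = trans (Σ-++ f xs (concat xss)) (+-congˡ (Σ-concat f xss))

  Σ-cartesianProductWith : ∀ (f : C → Carrier) (h : A → B → C) xs ys →
    Σ f (cartesianProductWith h xs ys) ≈ Σ (λ x → Σ (λ y → f (h x y)) ys) xs
  Σ-cartesianProductWith f h []       ys = refl
  Σ-cartesianProductWith f h (x ∷ xs) ys = begin
    Σ f (List.map (h x) ys ++ cartesianProductWith h xs ys)         ≈⟨ Σ-++ f (List.map (h x) ys) _ ⟩
    Σ f (List.map (h x) ys) + Σ f (cartesianProductWith h xs ys)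
      ≈⟨ +-cong (reflexive (Σ-map f (h x) ys)) (Σ-cartesianProductWith f h xs ys) ⟩
    Σ (λ y → f (h x y)) ys + Σ (λ x → Σ (λ y → f (h x y)) ys) xs   ∎

  Σ-upTo-suc : ∀ (f : ℕ → Carrier) n → Σ f (upTo (suc n)) ≡ f 0 + Σ (f ∘ suc) (upTo n)
  Σ-upTo-suc f n = ≡.cong (f 0 +_)
    (≡.trans (≡.cong (Σ f) (≡.sym (Listₚ.map-upTo suc n))) (Σ-map f suc (upTo n)))

  Σ-upTo-last : ∀ (f : ℕ → Carrier) n → Σ f (upTo (suc n)) ≈ Σ f (upTo n) + f n
  Σ-upTo-last f n = begin
    Σ f (upTo (suc n))            ≡⟨ ≡.cong (Σ f) (Listₚ.upTo-∷ʳ n) ⟨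
    Σ f (upTo n ++ (n ∷ []))      ≈⟨ Σ-++ f (upTo n) (n ∷ []) ⟩
    Σ f (upTo n) + (f n + 0#)     ≈⟨ +-congˡ (+-identityʳ (f n)) ⟩
    Σ f (upTo n) + f n            ∎

  Σ-move : ∀ (f : A → Carrier) xs y zs → Σ f (xs ++ y ∷ zs) ≈ f y + Σ f (xs ++ zs)
  Σ-move f []       y zs = refl
  Σ-move f (x ∷ xs) y zs = begin
    f x + Σ f (xs ++ y ∷ zs)      ≈⟨ +-congˡ (Σ-move f xs y zs) ⟩
    f x + (f y + Σ f (xs ++ zs))
      ≈⟨ solve 3 (λ a b c → a :+ (b :+ c) := b :+ (a :+ c)) refl (f x) (f y) _ ⟩
    f y + (f x + Σ f (xs ++ zs))  ∎

  -- Induction on `xs`: a head that also lies in `ys` is deleted from both lists, any other head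
  -- contributes zero. Different enumerations of an index set are compared in this way, so no
  -- permutation between lists has to be constructed.
  Σ-unique : DecidableEquality A → ∀ (f : A → Carrier) {xs ys} → Unique xs → Unique ys →
             (∀ {x} → x ∈ xs → x ∉ ys → f x ≈ 0#) →
             (∀ {y} → y ∈ ys → y ∉ xs → f y ≈ 0#) →
             Σ f xs ≈ Σ f ys
  Σ-unique _≟_ f {[]} {ys} _ _ _ vanish = sym (Σ-zero∈ ys (λ y∈ys → vanish y∈ys λ ()))
  Σ-unique _≟_ f {x ∷ xs} {ys} (x∉xs ∷ uxs) uys vanishˡ vanishʳ with _∈?_ _≟_ x ys
  ... | no x∉ys = begin
    f x + Σ f xs ≈⟨ +-congʳ (vanishˡ (here ≡.refl) x∉ys) ⟩
    0# + Σ f xs  ≈⟨ +-identityˡ _ ⟩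
    Σ f xs       ≈⟨ Σ-unique _≟_ f uxs uys (vanishˡ ∘ there) (λ y∈ys y∉xs → vanishʳ y∈ys λ
                      { (here ≡.refl) → x∉ys y∈ys ; (there y∈xs) → y∉xs y∈xs }) ⟩
    Σ f ys       ∎
  ... | yes x∈ys with as , bs , ≡.refl ← ∈-∃++ x∈ys = begin
    f x + Σ f xs          ≈⟨ +-congˡ (Σ-unique _≟_ f uxs (unique-drop as uys) vˡ vʳ) ⟩
    f x + Σ f (as ++ bs)  ≈⟨ Σ-move f as x bs ⟨
    Σ f (as ++ x ∷ bs)    ∎
    where
    ∈-insert : ∀ as {bs z} → z ∈ as ++ bs → z ∈ as ++ x ∷ bs
    ∈-insert []       z∈        = there z∈
    ∈-insert (a ∷ as) (here eq) = here eq
    ∈-insert (a ∷ as) (there z∈) = there (∈-insert as z∈)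

    ∈-remove : ∀ as {bs z} → z ∈ as ++ x ∷ bs → z ≢ x → z ∈ as ++ bs
    ∈-remove []       (here eq) z≢x = contradiction eq z≢x
    ∈-remove []       (there z∈) z≢x = z∈
    ∈-remove (a ∷ as) (here eq) z≢x = here eq
    ∈-remove (a ∷ as) (there z∈) z≢x = there (∈-remove as z∈ z≢x)

    unique-drop : ∀ as {bs} → Unique (as ++ x ∷ bs) → Unique (as ++ bs)
    unique-drop []       (_ ∷ u) = u
    unique-drop (a ∷ as) (a∉ ∷ u) = Listᴬ.tabulate (Listᴬ.lookup a∉ ∘ ∈-insert as) ∷ unique-drop as u

    x∉as++bs : ∀ as {bs} → Unique (as ++ x ∷ bs) → ∀ {z} → z ∈ as ++ bs → z ≢ x
    x∉as++bs []       (x∉ ∷ _) z∈ z≡x = Listᴬ.lookup x∉ z∈ (≡.sym z≡x)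
    x∉as++bs (a ∷ as) (a∉ ∷ _) (here ≡.refl) = Listᴬ.lookup a∉ (∈-++⁺ʳ as (here ≡.refl))
    x∉as++bs (a ∷ as) (_ ∷ u) (there z∈) = x∉as++bs as u z∈

    vˡ : ∀ {z} → z ∈ xs → z ∉ as ++ bs → f z ≈ 0#
    vˡ z∈ z∉ = vanishˡ (there z∈) λ z∈ys →
      z∉ (∈-remove as z∈ys λ z≡x → Listᴬ.lookup x∉xs z∈ (≡.sym z≡x))

    vʳ : ∀ {z} → z ∈ as ++ bs → z ∉ xs → f z ≈ 0#
    vʳ z∈ z∉ = vanishʳ (∈-insert as z∈) λ
      { (here z≡x) → x∉as++bs as uys z∈ z≡x ; (there z∈xs) → z∉ z∈xs }

module Convolution (R : CommutativeSemiring 0ℓ 0ℓ) where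
  open CommutativeSemiring R
  open import Relation.Binary.Reasoning.Setoid setoid
  open FiniteSum R
  open SemiringMult semiring using (×-comm-*) renaming (_×_ to infixr 8 _·_)
  open MonoidMult +-commutativeMonoid using (×-distrib-+)
  open NatSolver R using (solve; con; _:=_; _:+_; _:*_)

  Seq : Set
  Seq = ℕ → Carrier

  -- The recursion shifts the first sequence instead of using indices i and n - i. Without truncated
  -- subtraction the laws below are plain inductions; `conv≈Σ` recovers the usual form.
  conv : Seq → Seq → Seq
  conv a b zero    = a 0 * b 0
  conv a b (suc n) = a 0 * b (suc n) + conv (a ∘ suc) b n

  conv≈Σ : ∀ a b n → Σ (λ i → a i * b (n ∸ i)) (upTo (suc n)) ≈ conv a b n
  conv≈Σ a b zero    = +-identityʳ _
  conv≈Σ a b (suc n) = begin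
    Σ (λ i → a i * b (suc n ∸ i)) (upTo (suc (suc n)))
      ≡⟨ Σ-upTo-suc (λ i → a i * b (suc n ∸ i)) (suc n) ⟩
    a 0 * b (suc n) + Σ (λ i → a (suc i) * b (n ∸ i)) (upTo (suc n))
      ≈⟨ +-congˡ (conv≈Σ (a ∘ suc) b n) ⟩
    a 0 * b (suc n) + conv (a ∘ suc) b n ∎

  conv-cong : ∀ {a a′ b b′ : Seq} → (∀ i → a i ≈ a′ i) → (∀ i → b i ≈ b′ i) →
              ∀ n → conv a b n ≈ conv a′ b′ n
  conv-cong p q zero    = *-cong (p 0) (q 0)
  conv-cong p q (suc n) = +-cong (*-cong (p 0) (q (suc n))) (conv-cong (p ∘ suc) q n)

  conv-zeroˡ : ∀ {a b : Seq} → (∀ i → a i ≈ 0#) → ∀ n → conv a b n ≈ 0#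
  conv-zeroˡ p zero    = trans (*-congʳ (p 0)) (zeroˡ _)
  conv-zeroˡ p (suc n) =
    trans (+-cong (trans (*-congʳ (p 0)) (zeroˡ _)) (conv-zeroˡ (p ∘ suc) n)) (+-identityˡ 0#)

  conv-distribʳ : ∀ a a′ b n → conv (λ i → a i + a′ i) b n ≈ conv a b n + conv a′ b n
  conv-distribʳ a a′ b zero    = distribʳ _ _ _
  conv-distribʳ a a′ b (suc n) = begin
    (a 0 + a′ 0) * b (suc n) + conv (λ i → a (suc i) + a′ (suc i)) b n
      ≈⟨ +-congˡ (conv-distribʳ (a ∘ suc) (a′ ∘ suc) b n) ⟩
    (a 0 + a′ 0) * b (suc n) + (conv (a ∘ suc) b n + conv (a′ ∘ suc) b n)
      ≈⟨ solve 5 (λ x y z u v → (x :+ y) :* z :+ (u :+ v) := (x :* z :+ u) :+ (y :* z :+ v))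
           refl (a 0) (a′ 0) (b (suc n)) _ _ ⟩
    conv a b (suc n) + conv a′ b (suc n) ∎

  conv-*ˡ : ∀ c a b n → conv (λ i → c * a i) b n ≈ c * conv a b n
  conv-*ˡ c a b zero    = *-assoc _ _ _
  conv-*ˡ c a b (suc n) = begin
    (c * a 0) * b (suc n) + conv (λ i → c * a (suc i)) b n ≈⟨ +-cong (*-assoc _ _ _) (conv-*ˡ c (a ∘ suc) b n) ⟩
    c * (a 0 * b (suc n)) + c * conv (a ∘ suc) b n         ≈⟨ distribˡ c _ _ ⟨
    c * conv a b (suc n)                                   ∎

  -- The recursion of `conv` peels off the first entry of `a`; commutativity needs this mirror
  -- image, which peels off the last one.
  conv-last : ∀ a b n → conv a b (suc n) ≈ conv a (b ∘ suc) n + a (suc n) * b 0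
  conv-last a b zero    = refl
  conv-last a b (suc n) = begin
    a 0 * b (suc (suc n)) + conv (a ∘ suc) b (suc n)                              ≈⟨ +-congˡ (conv-last (a ∘ suc) b n) ⟩
    a 0 * b (suc (suc n)) + (conv (a ∘ suc) (b ∘ suc) n + a (suc (suc n)) * b 0)  ≈⟨ +-assoc _ _ _ ⟨
    conv a (b ∘ suc) (suc n) + a (suc (suc n)) * b 0                              ∎

  conv-comm : ∀ a b n → conv a b n ≈ conv b a n
  conv-comm a b zero    = *-comm _ _
  conv-comm a b (suc n) = begin
    a 0 * b (suc n) + conv (a ∘ suc) b n ≈⟨ +-cong (*-comm _ _) (conv-comm (a ∘ suc) b n) ⟩
    b (suc n) * a 0 + conv b (a ∘ suc) n ≈⟨ +-comm _ _ ⟩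
    conv b (a ∘ suc) n + b (suc n) * a 0 ≈⟨ conv-last b a n ⟨
    conv b a (suc n)                     ∎

  conv-assoc : ∀ a b c n → conv (conv a b) c n ≈ conv a (conv b c) n
  conv-assoc a b c zero    = *-assoc _ _ _
  conv-assoc a b c (suc n) = begin
    (a 0 * b 0) * c (suc n) + conv (λ i → a 0 * b (suc i) + conv (a ∘ suc) b i) c n
      ≈⟨ +-congˡ (conv-distribʳ _ _ c n) ⟩
    (a 0 * b 0) * c (suc n) + (conv (λ i → a 0 * b (suc i)) c n + conv (conv (a ∘ suc) b) c n)
      ≈⟨ +-congˡ (+-cong (conv-*ˡ (a 0) (b ∘ suc) c n) (conv-assoc (a ∘ suc) b c n)) ⟩
    (a 0 * b 0) * c (suc n) + (a 0 * conv (b ∘ suc) c n + conv (a ∘ suc) (conv b c) n)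
      ≈⟨ solve 5 (λ x y z u v → (x :* y) :* z :+ (x :* u :+ v) := x :* (y :* z :+ u) :+ v)
           refl (a 0) (b 0) (c (suc n)) _ _ ⟩
    a 0 * conv b c (suc n) + conv (a ∘ suc) (conv b c) n ∎

  ∂ : Seq → Seq
  ∂ a n = suc n · a (suc n)

  -- The product rule, `∂` being the derivative on the coefficients of a generating series. In the
  -- inductive step one of the n + 2 copies of the shifted convolution is set aside: it accounts for
  -- the difference between the shift of `∂ a` and `∂` of the shifted `a`. The other n + 1 copies
  -- fall under the induction hypothesis.
  conv-Leibniz : ∀ a b n → suc n · conv a b (suc n) ≈ conv (∂ a) b n + conv a (∂ b) n
  conv-Leibniz a b zero    = begin
    (a 0 * b 1 + a 1 * b 0) + 0#
      ≈⟨ solve 4 (λ x y z w → (x :* y :+ z :* w) :+ con 0 := (z :+ con 0) :* w :+ x :* (y :+ con 0))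
           refl (a 0) (b 1) (a 1) (b 0) ⟩
    (a 1 + 0#) * b 0 + a 0 * (b 1 + 0#) ∎
  conv-Leibniz a b (suc n) = begin
    suc (suc n) · (a 0 * b (2 ℕ.+ n) + conv (a ∘ suc) b (suc n))
      ≈⟨ ×-distrib-+ _ _ (suc (suc n)) ⟩
    suc (suc n) · (a 0 * b (2 ℕ.+ n)) + (conv (a ∘ suc) b (suc n) + suc n · conv (a ∘ suc) b (suc n))
      ≈⟨ +-cong (sym (×-comm-* (suc (suc n)) (a 0) _)) (+-congˡ (conv-Leibniz (a ∘ suc) b n)) ⟩
    a 0 * ∂ b (suc n) + ((a 1 * b (suc n) + conv (a ∘ suc ∘ suc) b n) + (conv (∂ (a ∘ suc)) b n + conv (a ∘ suc) (∂ b) n))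
      ≈⟨ solve 5 (λ x y z u v → x :+ ((y :+ z) :+ (u :+ v)) := (y :+ (z :+ u)) :+ (x :+ v)) refl _ _ _ _ _ ⟩
    (a 1 * b (suc n) + (conv (a ∘ suc ∘ suc) b n + conv (∂ (a ∘ suc)) b n)) + conv a (∂ b) (suc n)
      ≈⟨ +-congʳ (+-cong (*-congʳ (+-identityʳ (a 1))) (conv-distribʳ _ _ b n)) ⟨
    conv (∂ a) b (suc n) + conv a (∂ b) (suc n) ∎

  -- The left side runs over the triangle i + j ≤ n, the right side over the whole square, and the
  -- hypothesis annihilates the rest of the square. The terms of two exponential series satisfy it
  -- when equality is taken up to degree n.
  Σ-conv : ∀ n a b → (∀ i j → n < i ℕ.+ j → a i * b j ≈ 0#) →
           Σ (conv a b) (upTo (suc n)) ≈ Σ a (upTo (suc n)) * Σ b (upTo (suc n))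
  Σ-conv zero    a b ab≈0 = solve 2 (λ x y → x :* y :+ con 0 := (x :+ con 0) :* (y :+ con 0)) refl (a 0) (b 0)
  Σ-conv (suc n) a b ab≈0 = begin
    Σ (conv a b) (upTo (2 ℕ.+ n))
      ≡⟨ Σ-upTo-suc (conv a b) (suc n) ⟩
    a 0 * b 0 + Σ (λ k → a 0 * b (suc k) + conv (a ∘ suc) b k) (upTo (suc n))
      ≈⟨ +-congˡ (Σ-+ _ _ (upTo (suc n))) ⟩
    a 0 * b 0 + (Σ (λ k → a 0 * b (suc k)) (upTo (suc n)) + Σ (conv (a ∘ suc) b) (upTo (suc n)))
      ≈⟨ +-congˡ (+-cong (sym (*-Σ (a 0) _ (upTo (suc n)))) (Σ-conv n (a ∘ suc) b (λ i j n<i+j → ab≈0 (suc i) j (s≤s n<i+j)))) ⟩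
    a 0 * b 0 + (a 0 * Σ (b ∘ suc) (upTo (suc n)) + Σ (a ∘ suc) (upTo (suc n)) * Σ b (upTo (suc n)))
      ≈⟨ +-congˡ (+-congˡ extend) ⟩
    a 0 * b 0 + (a 0 * Σ (b ∘ suc) (upTo (suc n)) + Σ (a ∘ suc) (upTo (suc n)) * Σ b (upTo (2 ℕ.+ n)))
      ≈⟨ +-assoc _ _ _ ⟨
    (a 0 * b 0 + a 0 * Σ (b ∘ suc) (upTo (suc n))) + Σ (a ∘ suc) (upTo (suc n)) * Σ b (upTo (2 ℕ.+ n))
      ≈⟨ +-congʳ (distribˡ _ _ _) ⟨
    a 0 * (b 0 + Σ (b ∘ suc) (upTo (suc n))) + Σ (a ∘ suc) (upTo (suc n)) * Σ b (upTo (2 ℕ.+ n))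
      ≈⟨ +-congʳ (*-congˡ (reflexive (Σ-upTo-suc b (suc n)))) ⟨
    a 0 * Σ b (upTo (2 ℕ.+ n)) + Σ (a ∘ suc) (upTo (suc n)) * Σ b (upTo (2 ℕ.+ n))
      ≈⟨ distribʳ _ _ _ ⟨
    (a 0 + Σ (a ∘ suc) (upTo (suc n))) * Σ b (upTo (2 ℕ.+ n))
      ≡⟨ ≡.cong (_* Σ b (upTo (2 ℕ.+ n))) (Σ-upTo-suc a (suc n)) ⟨
    Σ a (upTo (2 ℕ.+ n)) * Σ b (upTo (2 ℕ.+ n)) ∎
    where
    A = Σ (a ∘ suc) (upTo (suc n))
    -- Completing the second factor adds the products of the a (suc i) with b (suc n), whose index
    -- sum is at least n + 2.
    extend : A * Σ b (upTo (suc n)) ≈ A * Σ b (upTo (2 ℕ.+ n))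
    extend = begin
      A * Σ b (upTo (suc n))                   ≈⟨ +-identityʳ _ ⟨
      A * Σ b (upTo (suc n)) + 0#              ≈⟨ +-congˡ (trans (Σ-* (b (suc n)) (a ∘ suc) (upTo (suc n)))
                                                    (Σ-zero∈ (upTo (suc n)) (λ {i} _ → ab≈0 (suc i) (suc n) (s≤s (ℕₚ.m≤n+m (suc n) i))))) ⟨
      A * Σ b (upTo (suc n)) + A * b (suc n)   ≈⟨ distribˡ A _ _ ⟨
      A * (Σ b (upTo (suc n)) + b (suc n))     ≈⟨ *-congˡ (Σ-upTo-last b (suc n)) ⟨
      A * Σ b (upTo (2 ℕ.+ n))                 ∎

open import Data.Fin using (Fin; zero; suc; _↑ˡ_; _↑ʳ_; opposite; inject₁; fromℕ; splitAt)
import Data.Fin.Properties as Finₚ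
open import Data.Integer as ℤ using (+_)
import Data.Integer.Properties as ℤₚ
open import Data.Rational using (ℚ; 0ℚ; 1ℚ; _/_; _+_; _*_; -_; toℚᵘ)
import Data.Rational.Properties as ℚₚ
open import Algebra.Properties.Group ℚₚ.+-0-group using (⁻¹-involutive)
open import Data.Rational.Unnormalised as ℚᵘ using (mkℚᵘ; *≡*)
import Data.Rational.Unnormalised.Properties as ℚᵘₚ
open import Defs

-- Rational arithmetic and divided powers

ℚ-semiring : CommutativeSemiring 0ℓ 0ℓ
ℚ-semiring = CommutativeRing.commutativeSemiring ℚₚ.+-*-commutativeRing

module Σℚ = FiniteSum ℚ-semiring

/-cross : ∀ a b c d .{{_ : NonZero b}} .{{_ : NonZero d}} → a ℕ.* d ≡ c ℕ.* b → + a / b ≡ + c / d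
/-cross a (suc b) c (suc d) eq = ℚₚ.fromℚᵘ-cong {mkℚᵘ (+ a) b} {mkℚᵘ (+ c) d}
  (*≡* (≡.trans (≡.sym (ℤₚ.pos-* a (suc d))) (≡.trans (≡.cong +_ eq) (ℤₚ.pos-* c (suc b)))))

toℚᵘ-/ : ∀ a b → toℚᵘ (+ a / suc b) ℚᵘ.≃ mkℚᵘ (+ a) b
toℚᵘ-/ a b = ℚₚ.toℚᵘ-fromℚᵘ (mkℚᵘ (+ a) b)

/-*-/ : ∀ a b c d .{{_ : NonZero b}} .{{_ : NonZero d}} .{{_ : NonZero (b ℕ.* d)}} →
        (+ a / b) * (+ c / d) ≡ + (a ℕ.* c) / (b ℕ.* d)
/-*-/ a (suc b) c (suc d) = ℚₚ.toℚᵘ-injective (begin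
  toℚᵘ ((+ a / suc b) * (+ c / suc d))          ≈⟨ ℚₚ.toℚᵘ-homo-* (+ a / suc b) (+ c / suc d) ⟩
  toℚᵘ (+ a / suc b) ℚᵘ.* toℚᵘ (+ c / suc d)    ≈⟨ ℚᵘₚ.*-cong (toℚᵘ-/ a b) (toℚᵘ-/ c d) ⟩
  mkℚᵘ (+ a) b ℚᵘ.* mkℚᵘ (+ c) d                ≡⟨ ≡.cong (λ z → mkℚᵘ z _) (ℤₚ.pos-* a c) ⟨
  mkℚᵘ (+ (a ℕ.* c)) (d ℕ.+ b ℕ.* suc d)        ≈⟨ toℚᵘ-/ (a ℕ.* c) _ ⟨
  toℚᵘ (+ (a ℕ.* c) / (suc b ℕ.* suc d))        ∎)
  where open import Relation.Binary.Reasoning.Setoid ℚᵘₚ.≃-setoid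

infix 10 ⟨_⟩
⟨_⟩ : ℕ → ℚ
⟨ n ⟩ = + n / 1

⟨⟩-+ : ∀ a b → ⟨ a ℕ.+ b ⟩ ≡ ⟨ a ⟩ + ⟨ b ⟩
⟨⟩-+ a b = ≡.sym (ℚₚ.toℚᵘ-injective (begin
  toℚᵘ (⟨ a ⟩ + ⟨ b ⟩)                ≈⟨ ℚₚ.toℚᵘ-homo-+ ⟨ a ⟩ ⟨ b ⟩ ⟩
  toℚᵘ ⟨ a ⟩ ℚᵘ.+ toℚᵘ ⟨ b ⟩          ≈⟨ ℚᵘₚ.+-cong (toℚᵘ-/ a 0) (toℚᵘ-/ b 0) ⟩
  mkℚᵘ (+ a) 0 ℚᵘ.+ mkℚᵘ (+ b) 0      ≡⟨ ≡.cong (λ z → mkℚᵘ z 0) (≡.cong₂ ℤ._+_ (ℤₚ.*-identityʳ (+ a)) (ℤₚ.*-identityʳ (+ b))) ⟩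
  mkℚᵘ (+ (a ℕ.+ b)) 0                ≈⟨ toℚᵘ-/ (a ℕ.+ b) 0 ⟨
  toℚᵘ ⟨ a ℕ.+ b ⟩                    ∎))
  where open import Relation.Binary.Reasoning.Setoid ℚᵘₚ.≃-setoid

⟨⟩-* : ∀ a b → ⟨ a ℕ.* b ⟩ ≡ ⟨ a ⟩ * ⟨ b ⟩
⟨⟩-* a b = ≡.sym (/-*-/ a 1 b 1)

-- Characteristic zero enters here: the differential equation of the exponential only determines n +
-- 1 times the next coefficient, and this division recovers the coefficient itself.
⟨suc⟩-cancel : ∀ n {p r} → ⟨ suc n ⟩ * p ≡ ⟨ suc n ⟩ * r → p ≡ r
⟨suc⟩-cancel n {p} {r} eq = ≡.trans (≡.sym (undo p)) (≡.trans (≡.cong ((+ 1 / suc n) *_) eq) (undo r))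
  where
  inv : (+ 1 / suc n) * ⟨ suc n ⟩ ≡ 1ℚ
  inv = ≡.trans (/-*-/ 1 (suc n) (suc n) 1) (/-cross (1 ℕ.* suc n) (suc n ℕ.* 1) 1 1 (ℕₚ.*-assoc 1 (suc n) 1))
  undo : ∀ p → (+ 1 / suc n) * (⟨ suc n ⟩ * p) ≡ p
  undo p = ≡.trans (≡.sym (ℚₚ.*-assoc (+ 1 / suc n) ⟨ suc n ⟩ p)) (≡.trans (≡.cong (_* p) inv) (ℚₚ.*-identityˡ p))

dividedPower-suc : ∀ x k → ⟨ suc k ⟩ * dividedPower x (suc k) ≡ ⟨ x ⟩ * dividedPower x k
dividedPower-suc x k = ≡.trans (/-*-/ (suc k) 1 (x ℕ.^ suc k) (suc k !))
  (≡.trans (/-cross (suc k ℕ.* x ℕ.^ suc k) (1 ℕ.* suc k !) (x ℕ.* x ℕ.^ k) (1 ℕ.* k !) (lemma x k (x ℕ.^ k) (k !)))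
    (≡.sym (/-*-/ x 1 (x ℕ.^ k) (k !))))
  where
  instance
    _ = k ℕₚ.!≢0
    _ = suc k ℕₚ.!≢0
    _ = ℕₚ.m*n≢0 1 (k !)
    _ = ℕₚ.m*n≢0 1 (suc k !)
  lemma : ∀ x k p f → suc k ℕ.* (x ℕ.* p) ℕ.* (1 ℕ.* f) ≡ x ℕ.* p ℕ.* (1 ℕ.* (suc k ℕ.* f))
  lemma = ℕSolver.solve-∀

dividedPower-^ : ∀ x k → dividedPower 1 k * ⟨ x ℕ.^ k ⟩ ≡ dividedPower x k
dividedPower-^ x k = ≡.trans (/-*-/ (1 ℕ.^ k) (k !) (x ℕ.^ k) 1)
  (/-cross (1 ℕ.^ k ℕ.* x ℕ.^ k) (k ! ℕ.* 1) (x ℕ.^ k) (k !)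
    (≡.trans (≡.cong (λ z → z ℕ.* x ℕ.^ k ℕ.* k !) (ℕₚ.^-zeroˡ k)) (lemma (x ℕ.^ k) (k !))))
  where
  instance
    _ = k ℕₚ.!≢0
    _ = ℕₚ.m*n≢0 (k !) 1
  lemma : ∀ p f → 1 ℕ.* p ℕ.* f ≡ p ℕ.* (f ℕ.* 1)
  lemma = ℕSolver.solve-∀

-- Power series

sum-splitting : ∀ (α : Vec ℕ m) {β γ} → (β , γ) ∈ splittings α → Vec.sum β ℕ.+ Vec.sum γ ≡ Vec.sum α
sum-splitting []      (here ≡.refl) = ≡.refl
sum-splitting (k ∷ α) βγ∈
  with i , (β , γ) , i∈ , βγ∈′ , ≡.refl ← ∈-cartesianProductWith⁻ _ (upTo (suc k)) (splittings α) βγ∈ = begin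
    (i ℕ.+ Vec.sum β) ℕ.+ (k ∸ i ℕ.+ Vec.sum γ) ≡⟨ interchange i (Vec.sum β) (k ∸ i) (Vec.sum γ) ⟩
    (i ℕ.+ (k ∸ i)) ℕ.+ (Vec.sum β ℕ.+ Vec.sum γ)
      ≡⟨ ≡.cong₂ ℕ._+_ (ℕₚ.m+[n∸m]≡n (ℕₚ.≤-pred (∈-upTo⁻ i∈))) (sum-splitting α βγ∈′) ⟩
    k ℕ.+ Vec.sum α                             ∎
  where
  open ≡-Reasoning
  interchange : ∀ a b c d → (a ℕ.+ b) ℕ.+ (c ℕ.+ d) ≡ (a ℕ.+ c) ℕ.+ (b ℕ.+ d)
  interchange = ℕSolver.solve-∀

infix 4 _≈[_]_
-- A record, so that both sides can be inferred from the type.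
record _≈[_]_ (f : PS m) (M : ℕ) (g : PS m) : Set where
  constructor mk
  field at : ∀ α → Vec.sum α ≤ M → f α ≡ g α

open _≈[_]_

-- The series with terms only in degrees above M form an ideal: both parts of a splitting of α have
-- total degree at most that of α.
⊗-cong[] : ∀ {M} {f f′ g g′ : PS m} → f ≈[ M ] f′ → g ≈[ M ] g′ → f ⊗ g ≈[ M ] f′ ⊗ g′
⊗-cong[] p q .at α |α|≤M = Σℚ.Σ-cong∈ (splittings α) λ {(β , γ)} βγ∈ →
  let eq = sum-splitting α βγ∈ in
  ≡.cong₂ _*_ (p .at β (ℕₚ.≤-trans (≡.subst (Vec.sum β ≤_) eq (ℕₚ.m≤m+n _ _)) |α|≤M))
              (q .at γ (ℕₚ.≤-trans (≡.subst (Vec.sum γ ≤_) eq (ℕₚ.m≤n+m _ _)) |α|≤M))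

≈⇒≈[] : ∀ {M} {f g : PS m} → f ≈ g → f ≈[ M ] g
≈⇒≈[] p .at α _ = p α

⊗-cong : {f f′ g g′ : PS m} → f ≈ f′ → g ≈ g′ → f ⊗ g ≈ f′ ⊗ g′
⊗-cong p q α = ⊗-cong[] {M = Vec.sum α} (≈⇒≈[] p) (≈⇒≈[] q) .at α ℕₚ.≤-refl

⊗-distribʳ : (h f g : PS m) → (f ⊕ g) ⊗ h ≈ (f ⊗ h) ⊕ (g ⊗ h)
⊗-distribʳ h f g α = ≡.trans
  (Σℚ.Σ-cong (splittings α) (λ (β , γ) → ℚₚ.*-distribʳ-+ (h γ) (f β) (g β)))
  (Σℚ.Σ-+ _ _ (splittings α))

⊗-zeroˡ : (f : PS m) → 0ₛ ⊗ f ≈ 0ₛ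
⊗-zeroˡ f α = Σℚ.Σ-zero∈ (splittings α) (λ {(β , γ)} _ → ℚₚ.*-zeroˡ (f γ))

≈-isEquivalence : IsEquivalence (_≈_ {m})
≈-isEquivalence = record
  { refl  = λ _ → ≡.refl
  ; sym   = λ p α → ≡.sym (p α)
  ; trans = λ p q α → ≡.trans (p α) (q α)
  }

⊕-isCommutativeMonoid : IsCommutativeMonoid (_≈_ {m}) _⊕_ 0ₛ
⊕-isCommutativeMonoid = record
  { isMonoid = record
    { isSemigroup = record
      { isMagma = record
        { isEquivalence = ≈-isEquivalence
        ; ∙-cong = λ p q α → ≡.cong₂ _+_ (p α) (q α)
        }
      ; assoc = λ f g h α → ℚₚ.+-assoc (f α) (g α) (h α)
      }
    ; identity = (λ f α → ℚₚ.+-identityˡ (f α)) , (λ f α → ℚₚ.+-identityʳ (f α))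
    }
  ; comm = λ f g α → ℚₚ.+-comm (f α) (g α)
  }

private
  isCommutativeSemiring-from : (∀ (f g h : PS m) → (f ⊗ g) ⊗ h ≈ f ⊗ (g ⊗ h)) →
    (∀ (f g : PS m) → f ⊗ g ≈ g ⊗ f) → (∀ (f : PS m) → 1ₛ ⊗ f ≈ f) →
    IsCommutativeSemiring (_≈_ {m}) _⊕_ _⊗_ 0ₛ 1ₛ
  isCommutativeSemiring-from assoc comm identityˡ = isCommutativeSemiringˡ record
    { +-isCommutativeMonoid = ⊕-isCommutativeMonoid
    ; *-isCommutativeMonoid = record
      { isMonoid = record
        { isSemigroup = record
          { isMagma = record { isEquivalence = ≈-isEquivalence ; ∙-cong = ⊗-cong }
          ; assoc = assoc
          }
        ; identity = identityˡ , λ f α → ≡.trans (comm f 1ₛ α) (identityˡ f α)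
        }
      ; comm = comm
      }
    ; distribʳ = ⊗-distribʳ
    ; zeroˡ = ⊗-zeroˡ
    }

⊕-sum-apply : ∀ {A : Set} (f : A → PS m) xs α →
              List.foldr _⊕_ 0ₛ (List.map f xs) α ≡ Σℚ.Σ (λ x → f x α) xs
⊕-sum-apply f []       α = ≡.refl
⊕-sum-apply f (x ∷ xs) α = ≡.cong (λ s → f x α + s) (⊕-sum-apply f xs α)

slice : PS (suc m) → ℕ → PS m
slice f i α = f (i ∷ α)

-- By induction on the number of variables: a series in m + 1 variables is the sequence of its
-- slices in the first variable, and its product is `conv` over the series in m variables, so the
-- laws of `conv` apply. The signature stands ahead of `slice-⊗` because that lemma already needs
-- the semiring in m variables.
PS-isCommutativeSemiring : ∀ m → IsCommutativeSemiring (_≈_ {m}) _⊕_ _⊗_ 0ₛ 1ₛ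

PS-semiring : ℕ → CommutativeSemiring 0ℓ 0ℓ
PS-semiring m = record { isCommutativeSemiring = PS-isCommutativeSemiring m }

slice-⊗ : ∀ (f g : PS (suc m)) k α →
          (f ⊗ g) (k ∷ α) ≡ Convolution.conv (PS-semiring m) (slice f) (slice g) k α
slice-⊗ {m} f g k α = begin
  (f ⊗ g) (k ∷ α)
    ≡⟨ Σℚ.Σ-cartesianProductWith _ _ (upTo (suc k)) (splittings α) ⟩
  Σℚ.Σ (λ i → (slice f i ⊗ slice g (k ∸ i)) α) (upTo (suc k))
    ≡⟨ ⊕-sum-apply (λ i → slice f i ⊗ slice g (k ∸ i)) (upTo (suc k)) α ⟨
  FiniteSum.Σ (PS-semiring m) (λ i → slice f i ⊗ slice g (k ∸ i)) (upTo (suc k)) α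
    ≡⟨ Convolution.conv≈Σ (PS-semiring m) (slice f) (slice g) k α ⟩
  Convolution.conv (PS-semiring m) (slice f) (slice g) k α ∎
  where open ≡-Reasoning

PS-isCommutativeSemiring zero = isCommutativeSemiring-from
  (λ { f g h [] → lemma₁ (f []) (g []) (h []) })
  (λ { f g [] → ≡.cong (_+ 0ℚ) (ℚₚ.*-comm (f []) (g [])) })
  (λ { f [] → ≡.trans (ℚₚ.+-identityʳ _) (ℚₚ.*-identityˡ (f [])) })
  where
  lemma₁ : ∀ a b c → (a * b + 0ℚ) * c + 0ℚ ≡ a * (b * c + 0ℚ) + 0ℚ
  lemma₁ a b c = ≡.cong (_+ 0ℚ) (≡.trans (≡.cong (_* c) (ℚₚ.+-identityʳ (a * b)))
    (≡.trans (ℚₚ.*-assoc a b c) (≡.cong (a *_) (≡.sym (ℚₚ.+-identityʳ (b * c))))))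
PS-isCommutativeSemiring (suc m) = isCommutativeSemiring-from
  (λ { f g h (k ∷ α) → begin
    ((f ⊗ g) ⊗ h) (k ∷ α)                        ≡⟨ slice-⊗ (f ⊗ g) h k α ⟩
    conv (slice (f ⊗ g)) (slice h) k α           ≡⟨ conv-cong (slice-⊗ f g) (λ _ _ → ≡.refl) k α ⟩
    conv (conv (slice f) (slice g)) (slice h) k α ≡⟨ conv-assoc (slice f) (slice g) (slice h) k α ⟩
    conv (slice f) (conv (slice g) (slice h)) k α ≡⟨ conv-cong {a = slice f} (λ _ _ → ≡.refl) (slice-⊗ g h) k α ⟨
    conv (slice f) (slice (g ⊗ h)) k α           ≡⟨ slice-⊗ f (g ⊗ h) k α ⟨
    (f ⊗ (g ⊗ h)) (k ∷ α)                        ∎ })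
  (λ { f g (k ∷ α) → begin
    (f ⊗ g) (k ∷ α)              ≡⟨ slice-⊗ f g k α ⟩
    conv (slice f) (slice g) k α ≡⟨ conv-comm (slice f) (slice g) k α ⟩
    conv (slice g) (slice f) k α ≡⟨ slice-⊗ g f k α ⟨
    (g ⊗ f) (k ∷ α)              ∎ })
  (λ { f (k ∷ α) → ≡.trans (slice-⊗ 1ₛ f k α) (conv-1 (slice f) k α) })
  where
  open ≡-Reasoning
  open Convolution (PS-semiring m)
  open IsCommutativeSemiring (PS-isCommutativeSemiring m) using (*-identityˡ; +-identityʳ)
  conv-1 : ∀ (a : ℕ → PS m) k → conv (slice 1ₛ) a k ≈ a k
  conv-1 a zero    = *-identityˡ (a 0)
  conv-1 a (suc k) α = ≡.trans
    (≡.cong₂ _+_ (*-identityˡ (a (suc k)) α) (conv-zeroˡ {b = a} (λ _ _ → ≡.refl) k α))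
    (ℚₚ.+-identityʳ (a (suc k) α))

-- The same operations under the coarser equality, so that the lemmas on sums and convolutions and
-- the solver apply directly to identities up to degree M.
PS-semiring[_] : ℕ → ∀ m → CommutativeSemiring 0ℓ 0ℓ
PS-semiring[ M ] m = record { isCommutativeSemiring = isCommutativeSemiringˡ {_≈_ = _≈[M]_} record
  { +-isCommutativeMonoid = record
    { isMonoid = record
      { isSemigroup = record
        { isMagma = record
          { isEquivalence = equiv
          ; ∙-cong = λ p q → mk λ α h → ≡.cong₂ _+_ (p .at α h) (q .at α h)
          }
        ; assoc = λ f g h → ≈⇒≈[] (R.+-assoc f g h)
        }
      ; identity = (λ f → ≈⇒≈[] (R.+-identityˡ f)) , (λ f → ≈⇒≈[] (R.+-identityʳ f))
      }
    ; comm = λ f g → ≈⇒≈[] (R.+-comm f g)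
    }
  ; *-isCommutativeMonoid = record
    { isMonoid = record
      { isSemigroup = record
        { isMagma = record { isEquivalence = equiv ; ∙-cong = ⊗-cong[] }
        ; assoc = λ f g h → ≈⇒≈[] (R.*-assoc f g h)
        }
      ; identity = (λ f → ≈⇒≈[] (R.*-identityˡ f)) , (λ f → ≈⇒≈[] (R.*-identityʳ f))
      }
    ; comm = λ f g → ≈⇒≈[] (R.*-comm f g)
    }
  ; distribʳ = λ f g h → ≈⇒≈[] (R.distribʳ f g h)
  ; zeroˡ = λ f → ≈⇒≈[] (R.zeroˡ f)
  } }
  where
  module R = CommutativeSemiring (PS-semiring m)
  _≈[M]_ : PS m → PS m → Set
  f ≈[M] g = f ≈[ M ] g
  equiv : IsEquivalence _≈[M]_
  equiv = record
    { refl  = mk λ _ _ → ≡.refl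
    ; sym   = λ p → mk λ α h → ≡.sym (p .at α h)
    ; trans = λ p q → mk λ α h → ≡.trans (p .at α h) (q .at α h)
    }

-- Order of vanishing in total degree

Ord : ℕ → PS m → Set
Ord k f = ∀ α → Vec.sum α < k → f α ≡ 0ℚ

Ord-0 : (f : PS m) → Ord 0 f
Ord-0 f α ()

Ord⇒≈0 : ∀ {k M} {f : PS m} → Ord k f → M < k → f ≈[ M ] 0ₛ
Ord⇒≈0 o M<k .at α |α|≤M = o α (ℕₚ.≤-<-trans |α|≤M M<k)

Ord-⊕ : ∀ {k} {f g : PS m} → Ord k f → Ord k g → Ord k (f ⊕ g)
Ord-⊕ p q α h = ≡.cong₂ _+_ (p α h) (q α h)

Ord-⊖ : ∀ {k} {f g : PS m} → Ord k f → Ord k g → Ord k (f ⊖ g)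
Ord-⊖ p q α h = ≡.cong₂ (λ x y → x + (- y)) (p α h) (q α h)

Ord-⊗ : ∀ {j k} {f g : PS m} → Ord j f → Ord k g → Ord (j ℕ.+ k) (f ⊗ g)
Ord-⊗ {j = j} {k} {f} {g} p q α h = Σℚ.Σ-zero∈ (splittings α) vanish
  where
  vanish : ∀ {βγ} → βγ ∈ splittings α → f (proj₁ βγ) * g (proj₂ βγ) ≡ 0ℚ
  vanish {β , γ} βγ∈ with Vec.sum β ℕ.<? j | Vec.sum γ ℕ.<? k
  ... | yes |β|<j | _         = ≡.trans (≡.cong (_* g γ) (p β |β|<j)) (ℚₚ.*-zeroˡ (g γ))
  ... | no _      | yes |γ|<k = ≡.trans (≡.cong (f β *_) (q γ |γ|<k)) (ℚₚ.*-zeroʳ (f β))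
  ... | no |β|≮j  | no |γ|≮k  = contradiction h (ℕₚ.≤⇒≯
    (≡.subst (j ℕ.+ k ≤_) (sum-splitting α βγ∈) (ℕₚ.+-mono-≤ (ℕₚ.≮⇒≥ |β|≮j) (ℕₚ.≮⇒≥ |γ|≮k))))

Ord-↑ : {f : PS m} → Ord 1 f → ∀ k → Ord k (f ↑ k)
Ord-↑ {f = f} o zero = Ord-0 (f ↑ 0)
Ord-↑ o (suc k) = Ord-⊗ o (Ord-↑ o k)

Ord-⊗ˡ : ∀ {k} {f : PS m} (g : PS m) → Ord k f → Ord k (f ⊗ g)
Ord-⊗ˡ {k = k} {f} g o = ≡.subst (λ j → Ord j (f ⊗ g)) (ℕₚ.+-identityʳ k) (Ord-⊗ {f = f} {g} o (Ord-0 g))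

Ord-∏ : ∀ {k} (f : Vector (PS m) l) i → Ord k (f i) → Ord k (∏ f)
Ord-∏ f zero    o = Ord-⊗ˡ (∏ (f ∘ suc)) o
Ord-∏ f (suc i) o = Ord-⊗ {f = f zero} {∏ (f ∘ suc)} (Ord-0 (f zero)) (Ord-∏ (f ∘ suc) i o)

-- Boxes of exponent vectors

box-unique : ∀ n N → Unique (box n N)
box-unique zero    N = Listᴬ.[] ∷ []
box-unique (suc n) N = Uniqueₚ.cartesianProductWith⁺ _∷_ Vecₚ.∷-injective (Uniqueₚ.upTo⁺ (suc N)) (box-unique n N)

∈-box⁺ : ∀ {N} (α : Vec ℕ n) → (∀ i → lookup α i ≤ N) → α ∈ box n N
∈-box⁺ []      α≤N = here ≡.refl
∈-box⁺ (a ∷ α) α≤N = ∈-cartesianProductWith⁺ _∷_ (∈-upTo⁺ (s≤s (α≤N zero))) (∈-box⁺ α (α≤N ∘ suc))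

∈-box⁻ : ∀ {N} {α : Vec ℕ n} → α ∈ box n N → ∀ i → lookup α i ≤ N
∈-box⁻ {suc n} {N} α∈ i
  with a , α′ , a∈ , α′∈ , ≡.refl ← ∈-cartesianProductWith⁻ _∷_ (upTo (suc N)) (box n N) α∈
  with i
... | zero   = ℕₚ.≤-pred (∈-upTo⁻ a∈)
... | suc i′ = ∈-box⁻ α′∈ i′

∉-box : ∀ {N} {α : Vec ℕ n} → α ∉ box n N → ∃[ i ] N < lookup α i
∉-box {n} {N} {α} α∉ with i , α≰N ← Finₚ.¬∀⟶∃¬ n _ (λ i → lookup α i ℕ.≤? N) (α∉ ∘ ∈-box⁺ α) = i , ℕₚ.≰⇒> α≰N

-- `inverse` expands in powers of 1 - f and is applied to f = 1 - g, so the series raised to powers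
-- is 1 - (1 - g) and must be recognised as g. Negation lies outside the semiring structure, hence
-- this is done on coefficients.
a-[a-b]≡b : ∀ a b → a + (- (a + (- b))) ≡ b
a-[a-b]≡b a b = begin
  a + (- (a + (- b)))      ≡⟨ ≡.cong (λ z → a + z) (ℚₚ.neg-distrib-+ a (- b)) ⟩
  a + ((- a) + (- (- b)))  ≡⟨ ℚₚ.+-assoc a (- a) _ ⟨
  (a + (- a)) + (- (- b))  ≡⟨ ≡.cong₂ _+_ (ℚₚ.+-inverseʳ a) (⁻¹-involutive b) ⟩
  0ℚ + b                   ≡⟨ ℚₚ.+-identityˡ b ⟩
  b                        ∎
  where open ≡-Reasoning

infixr 7 _⋆_
_⋆_ : ℚ → PS m → PS m
(c ⋆ f) α = c * f α

Ord-⋆ : ∀ {k} {f : PS m} c → Ord k f → Ord k (c ⋆ f)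
Ord-⋆ c o α h = ≡.trans (≡.cong (c *_) (o α h)) (ℚₚ.*-zeroʳ c)

-- Substitution, geometric series and exponentials up to degree M

module Truncated (m M : ℕ) where
  open CommutativeSemiring (PS-semiring[ M ] m) public using () renaming
    ( _≈_ to _≋_; refl to ≋-refl; sym to ≋-sym; trans to ≋-trans; setoid to ≋-setoid
    ; reflexive to ≋-reflexive
    ; +-cong to ⊕-cong
    ; +-identityʳ to ⊕-identityʳ
    ; *-cong to ⊗-cong≋; *-assoc to ⊗-assoc; *-comm to ⊗-comm
    ; *-identityˡ to ⊗-identityˡ; *-identityʳ to ⊗-identityʳ
    ; distribʳ to ⊗-distribʳ≋; zeroˡ to ⊗-zeroˡ≋ )
  open FiniteSum (PS-semiring[ M ] m) public
  open Convolution (PS-semiring[ M ] m)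
  open SemiringMult (CommutativeSemiring.semiring (PS-semiring[ M ] m)) using () renaming (_×_ to infixr 8 _·_)
  open NatSolver (PS-semiring[ M ] m) public using (solve; _:=_; _:*_)
  open import Relation.Binary.Reasoning.Setoid ≋-setoid

  Σ-apply : ∀ {A : Set} (f : A → PS m) xs α → Σ f xs α ≡ Σℚ.Σ (λ x → f x α) xs
  Σ-apply = ⊕-sum-apply

  ⊗-congˡ : ∀ f {g h : PS m} → g ≋ h → f ⊗ g ≋ f ⊗ h
  ⊗-congˡ f g≋h = ⊗-cong≋ (≋-refl {f}) g≋h

  ⋆-congˡ : ∀ c {f g : PS m} → f ≋ g → c ⋆ f ≋ c ⋆ g
  ⋆-congˡ c f≋g .at α h = ≡.cong (c *_) (f≋g .at α h)

  ⋆-congʳ : ∀ (f : PS m) {c d} → c ≡ d → c ⋆ f ≋ d ⋆ f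
  ⋆-congʳ f c≡d = ≋-reflexive (≡.cong (_⋆ f) c≡d)

  ⋆-⊗ : ∀ c (f g : PS m) → (c ⋆ f) ⊗ g ≋ c ⋆ (f ⊗ g)
  ⋆-⊗ c f g .at α _ = ≡.trans
    (Σℚ.Σ-cong (splittings α) (λ (β , γ) → ℚₚ.*-assoc c (f β) (g γ)))
    (≡.sym (Σℚ.*-Σ c _ (splittings α)))

  ⊗-⋆ : ∀ c (f g : PS m) → f ⊗ (c ⋆ g) ≋ c ⋆ (f ⊗ g)
  ⊗-⋆ c f g = ≋-trans (⊗-comm f (c ⋆ g)) (≋-trans (⋆-⊗ c g f) (⋆-congˡ c (⊗-comm g f)))

  ⋆-⋆ : ∀ c d (f : PS m) → c ⋆ d ⋆ f ≋ (c * d) ⋆ f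
  ⋆-⋆ c d f .at α _ = ≡.sym (ℚₚ.*-assoc c d (f α))

  ⋆-⊗-⋆ : ∀ c d (f g : PS m) → (c ⋆ f) ⊗ (d ⋆ g) ≋ (c * d) ⋆ (f ⊗ g)
  ⋆-⊗-⋆ c d f g = ≋-trans (⋆-⊗ c f (d ⋆ g)) (≋-trans (⋆-congˡ c (⊗-⋆ d f g)) (⋆-⋆ c d (f ⊗ g)))

  1⋆ : ∀ (f : PS m) → 1ℚ ⋆ f ≋ f
  1⋆ f .at α _ = ℚₚ.*-identityˡ (f α)

  Σ-⋆ : ∀ {A : Set} (c : A → ℚ) (f : PS m) xs → Σ (λ x → c x ⋆ f) xs ≋ Σℚ.Σ c xs ⋆ f
  Σ-⋆ c f xs .at α _ = ≡.trans (Σ-apply _ xs α) (≡.sym (Σℚ.Σ-* (f α) c xs))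

  -- The product rule for `conv` is stated with repeated addition, the only multiple available in a
  -- general semiring; rational scalars are what permits division.
  ·≋⋆ : ∀ k (f : PS m) → k · f ≋ ⟨ k ⟩ ⋆ f
  ·≋⋆ zero    f .at α _ = ≡.sym (ℚₚ.*-zeroˡ (f α))
  ·≋⋆ (suc k) f .at α h = ≡.trans (≡.cong (λ z → f α + z) (·≋⋆ k f .at α h)) (≡.sym (suc-⋆ k (f α)))
    where
    suc-⋆ : ∀ k p → ⟨ suc k ⟩ * p ≡ p + ⟨ k ⟩ * p
    suc-⋆ k p = ≡.trans (≡.cong (_* p) (⟨⟩-+ 1 k)) (≡.trans (ℚₚ.*-distribʳ-+ p 1ℚ ⟨ k ⟩)
      (≡.cong (_+ ⟨ k ⟩ * p) (ℚₚ.*-identityˡ p)))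

  ·-cancel : ∀ k {f g : PS m} → suc k · f ≋ suc k · g → f ≋ g
  ·-cancel k {f} {g} eq .at α h = ⟨suc⟩-cancel k
    (≋-trans (≋-sym (·≋⋆ (suc k) f)) (≋-trans eq (·≋⋆ (suc k) g)) .at α h)

  suc-• : ∀ k (f : PS m) → suc k • f ≋ f ⊕ k • f
  suc-• k f = ≋-trans (≋-sym (·≋⋆ (suc k) f)) (⊕-cong (≋-refl {f}) (·≋⋆ k f))

  ↑-cong : ∀ {f g : PS m} → f ≋ g → ∀ k → f ↑ k ≋ g ↑ k
  ↑-cong f≋g zero    = ≋-refl
  ↑-cong f≋g (suc k) = ⊗-cong≋ f≋g (↑-cong f≋g k)

  ↑-⊗ : ∀ (f g : PS m) k → (f ⊗ g) ↑ k ≋ f ↑ k ⊗ g ↑ k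
  ↑-⊗ f g zero    = ≋-sym (⊗-identityˡ 1ₛ)
  ↑-⊗ f g (suc k) = ≋-trans (⊗-congˡ (f ⊗ g) (↑-⊗ f g k))
    (solve 4 (λ a b c d → (a :* b) :* (c :* d) := (a :* c) :* (b :* d)) ≋-refl f g (f ↑ k) (g ↑ k))

  ↑-+ : ∀ (f : PS m) j k → f ↑ (j ℕ.+ k) ≋ f ↑ j ⊗ f ↑ k
  ↑-+ f zero    k = ≋-sym (⊗-identityˡ _)
  ↑-+ f (suc j) k = ≋-trans (⊗-congˡ f (↑-+ f j k)) (≋-sym (⊗-assoc f (f ↑ j) (f ↑ k)))

  ↑-* : ∀ (f : PS m) j k → (f ↑ j) ↑ k ≋ f ↑ (j ℕ.* k)
  ↑-* f j zero    = ≋-reflexive (≡.cong (f ↑_) (≡.sym (ℕₚ.*-zeroʳ j)))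
  ↑-* f j (suc k) = begin
    f ↑ j ⊗ (f ↑ j) ↑ k    ≈⟨ ⊗-congˡ (f ↑ j) (↑-* f j k) ⟩
    f ↑ j ⊗ f ↑ (j ℕ.* k)  ≈⟨ ↑-+ f j (j ℕ.* k) ⟨
    f ↑ (j ℕ.+ j ℕ.* k)    ≡⟨ ≡.cong (f ↑_) (ℕₚ.*-suc j k) ⟨
    f ↑ (j ℕ.* suc k)      ∎

  •-↑ : ∀ v (f : PS m) k → (v • f) ↑ k ≋ ⟨ v ℕ.^ k ⟩ ⋆ f ↑ k
  •-↑ v f zero    = ≋-sym (1⋆ 1ₛ)
  •-↑ v f (suc k) = begin
    (⟨ v ⟩ ⋆ f) ⊗ (v • f) ↑ k            ≈⟨ ⊗-congˡ (v • f) (•-↑ v f k) ⟩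
    (⟨ v ⟩ ⋆ f) ⊗ (⟨ v ℕ.^ k ⟩ ⋆ f ↑ k)  ≈⟨ ⋆-⊗-⋆ ⟨ v ⟩ ⟨ v ℕ.^ k ⟩ f (f ↑ k) ⟩
    (⟨ v ⟩ * ⟨ v ℕ.^ k ⟩) ⋆ f ↑ suc k    ≈⟨ ⋆-congʳ (f ↑ suc k) (⟨⟩-* v (v ℕ.^ k)) ⟨
    ⟨ v ℕ.^ suc k ⟩ ⋆ f ↑ suc k          ∎

  ∏-cong : ∀ {f g : Vector (PS m) l} → (∀ j → f j ≋ g j) → ∏ f ≋ ∏ g
  ∏-cong {zero}  f≋g = ≋-refl
  ∏-cong {suc l} f≋g = ⊗-cong≋ (f≋g zero) (∏-cong (f≋g ∘ suc))

  ∏-⊗ : ∀ (f g : Vector (PS m) l) → ∏ (λ j → f j ⊗ g j) ≋ ∏ f ⊗ ∏ g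
  ∏-⊗ {zero}  f g = ≋-sym (⊗-identityˡ 1ₛ)
  ∏-⊗ {suc l} f g = ≋-trans (⊗-congˡ (f zero ⊗ g zero) (∏-⊗ (f ∘ suc) (g ∘ suc)))
    (solve 4 (λ a b c d → (a :* b) :* (c :* d) := (a :* c) :* (b :* d)) ≋-refl (f zero) (g zero) (∏ (f ∘ suc)) (∏ (g ∘ suc)))

  ∏-⋆ : ∀ (c : Vector ℚ l) (f : Vector (PS m) l) → ∏ (λ j → c j ⋆ f j) ≋ F.foldr _*_ 1ℚ c ⋆ ∏ f
  ∏-⋆ {zero}  c f = ≋-sym (1⋆ 1ₛ)
  ∏-⋆ {suc l} c f = ≋-trans (⊗-congˡ (c zero ⋆ f zero) (∏-⋆ (c ∘ suc) (f ∘ suc))) (⋆-⊗-⋆ (c zero) (F.foldr _*_ 1ℚ (c ∘ suc)) (f zero) (∏ (f ∘ suc)))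

  ∏-Σ : ∀ (h : Fin l → ℕ → PS m) N →
        ∏ (λ j → Σ (h j) (upTo (suc N))) ≋ Σ (λ a → ∏ (λ j → h j (lookup a j))) (box l N)
  ∏-Σ {zero}  h N = ≋-sym (⊕-identityʳ 1ₛ)
  ∏-Σ {suc l} h N = begin
    Σ (h zero) (upTo (suc N)) ⊗ ∏ (λ j → Σ (h (suc j)) (upTo (suc N)))
      ≈⟨ ⊗-congˡ (Σ (h zero) (upTo (suc N))) (∏-Σ (h ∘ suc) N) ⟩
    Σ (h zero) (upTo (suc N)) ⊗ Σ (λ a → ∏ (λ j → h (suc j) (lookup a j))) (box l N)
      ≈⟨ Σ-*-Σ (h zero) _ (upTo (suc N)) (box l N) ⟩
    Σ (λ i → Σ (λ a → h zero i ⊗ ∏ (λ j → h (suc j) (lookup a j))) (box l N)) (upTo (suc N))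
      ≈⟨ Σ-cartesianProductWith (λ a → ∏ (λ j → h j (lookup a j))) _∷_ (upTo (suc N)) (box l N) ⟨
    Σ (λ a → ∏ (λ j → h j (lookup a j))) (box (suc l) N) ∎

  -- The definition sums over a box whose side is the degree of β. It may be enlarged to side M for
  -- every β of degree at most M: each new α has an exponent above the degree of β, and the
  -- corresponding power alone has too high an order to contribute at β.
  ⟦⟧-truncate : ∀ (f : PS n) (g : Vector (PS m) n) → (∀ i → Ord 1 (g i)) →
                f ⟦ g ⟧ ≋ Σ (λ α → f α ⋆ ∏ (λ i → g i ↑ lookup α i)) (box n M)
  ⟦⟧-truncate {n} f g o .at β |β|≤M = ≡.trans
    (Σℚ.Σ-unique (Vecₚ.≡-dec ℕ._≟_) _ (box-unique n (Vec.sum β)) (box-unique n M)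
      (λ {α} α∈ α∉ → contradiction (∈-box⁺ α (λ i → ℕₚ.≤-trans (∈-box⁻ α∈ i) |β|≤M)) α∉)
      (λ {α} _ α∉ → vanish α (∉-box α∉)))
    (≡.sym (Σ-apply _ (box n M) β))
    where
    vanish : ∀ α → ∃[ i ] Vec.sum β < lookup α i → f α * ∏ (λ i → g i ↑ lookup α i) β ≡ 0ℚ
    vanish α (i , |β|<αᵢ) = Ord-⋆ (f α)
      (Ord-∏ (λ i → g i ↑ lookup α i) i (Ord-↑ (o i) (lookup α i))) β |β|<αᵢ

  Σ-box₁ : ∀ (h : Vec ℕ 1 → PS m) N → Σ h (box 1 N) ≋ Σ (λ k → h (k ∷ [])) (upTo (suc N))
  Σ-box₁ h N = ≋-trans (Σ-cartesianProductWith h _∷_ (upTo (suc N)) ([] ∷ []))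
    (Σ-cong (upTo (suc N)) (λ k → ⊕-identityʳ (h (k ∷ []))))

  γ : PS m → ℕ → PS m
  γ f k = dividedPower 1 k ⋆ f ↑ k

  exp-truncate : ∀ {f : PS m} → Ord 1 f → exp f ≋ Σ (γ f) (upTo (suc M))
  exp-truncate {f} o = ≋-trans (⟦⟧-truncate (λ α → dividedPower 1 (Vec.head α)) (f F.∷ F.[]) (λ { zero → o }))
    (≋-trans
      (Σ-box₁ (λ α → dividedPower 1 (Vec.head α) ⋆ ∏ (λ i → (f F.∷ F.[]) i ↑ lookup α i)) M)
      (Σ-cong (upTo (suc M)) (λ k → ⋆-congˡ (dividedPower 1 k) (⊗-identityʳ (f ↑ k)))))

  inverse-1⊖ : ∀ {g : PS m} → Ord 1 g → inverse (1ₛ ⊖ g) ≋ Σ (g ↑_) (upTo (suc M))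
  inverse-1⊖ {g} o = ≋-trans (⟦⟧-truncate (λ _ → 1ℚ) (g″ F.∷ F.[])
      (λ { zero α h → ≡.trans (a-[a-b]≡b (1ₛ α) (g α)) (o α h) }))
    (≋-trans (Σ-box₁ (λ α → 1ℚ ⋆ ∏ (λ i → (g″ F.∷ F.[]) i ↑ lookup α i)) M) (Σ-cong (upTo (suc M)) (λ k →
      ≋-trans (1⋆ (g″ ↑ k ⊗ 1ₛ)) (≋-trans (⊗-identityʳ (g″ ↑ k)) (↑-cong (mk λ α _ → a-[a-b]≡b (1ₛ α) (g α)) k)))))
    where g″ = 1ₛ ⊖ (1ₛ ⊖ g)


  -- The sequence `γ f` lists the coefficients of exp(tf) in an auxiliary variable t, and `∂` is
  -- d/dt.
  ∂-γ : ∀ f n → ∂ (γ f) n ≋ f ⊗ γ f n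
  ∂-γ f n = begin
    suc n · γ f (suc n)                                          ≈⟨ ·≋⋆ (suc n) (γ f (suc n)) ⟩
    ⟨ suc n ⟩ ⋆ dividedPower 1 (suc n) ⋆ f ↑ suc n               ≈⟨ ⋆-⋆ ⟨ suc n ⟩ (dividedPower 1 (suc n)) (f ↑ suc n) ⟩
    (⟨ suc n ⟩ * dividedPower 1 (suc n)) ⋆ f ↑ suc n             ≈⟨ ⋆-congʳ (f ↑ suc n) (≡.trans (dividedPower-suc 1 n) (ℚₚ.*-identityˡ (dividedPower 1 n))) ⟩
    dividedPower 1 n ⋆ (f ⊗ f ↑ n)                               ≈⟨ ⊗-⋆ (dividedPower 1 n) f (f ↑ n) ⟨
    f ⊗ γ f n                                                    ∎

  -- Both sides c satisfy c₀ = 1 and (n + 1) c₍ₙ₊₁₎ = (f + g) cₙ.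
  γ-⊕ : ∀ f g n → γ (f ⊕ g) n ≋ conv (γ f) (γ g) n
  γ-⊕ f g zero    = ≋-sym (≋-trans (⊗-cong≋ (1⋆ 1ₛ) (1⋆ 1ₛ)) (≋-trans (⊗-identityˡ 1ₛ) (≋-sym (1⋆ 1ₛ))))
  γ-⊕ f g (suc n) = ·-cancel n (begin
    suc n · γ (f ⊕ g) (suc n)                             ≈⟨ ∂-γ (f ⊕ g) n ⟩
    (f ⊕ g) ⊗ γ (f ⊕ g) n                                 ≈⟨ ⊗-congˡ (f ⊕ g) (γ-⊕ f g n) ⟩
    (f ⊕ g) ⊗ conv (γ f) (γ g) n                          ≈⟨ ⊗-distribʳ≋ (conv (γ f) (γ g) n) f g ⟩
    f ⊗ conv (γ f) (γ g) n ⊕ g ⊗ conv (γ f) (γ g) n       ≈⟨ ⊕-cong left right ⟨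
    conv (∂ (γ f)) (γ g) n ⊕ conv (γ f) (∂ (γ g)) n       ≈⟨ conv-Leibniz (γ f) (γ g) n ⟨
    suc n · conv (γ f) (γ g) (suc n)                      ∎)
    where
    left : conv (∂ (γ f)) (γ g) n ≋ f ⊗ conv (γ f) (γ g) n
    left = ≋-trans (conv-cong (∂-γ f) (λ _ → ≋-refl) n) (conv-*ˡ f (γ f) (γ g) n)
    right : conv (γ f) (∂ (γ g)) n ≋ g ⊗ conv (γ f) (γ g) n
    right = begin
      conv (γ f) (∂ (γ g)) n              ≈⟨ conv-cong (λ _ → ≋-refl) (∂-γ g) n ⟩
      conv (γ f) (λ i → g ⊗ γ g i) n      ≈⟨ conv-comm (γ f) _ n ⟩
      conv (λ i → g ⊗ γ g i) (γ f) n      ≈⟨ conv-*ˡ g (γ g) (γ f) n ⟩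
      g ⊗ conv (γ g) (γ f) n              ≈⟨ ⊗-congˡ g (conv-comm (γ g) (γ f) n) ⟩
      g ⊗ conv (γ f) (γ g) n              ∎

  exp-⊕ : ∀ {f g : PS m} → Ord 1 f → Ord 1 g → exp (f ⊕ g) ≋ exp f ⊗ exp g
  exp-⊕ {f} {g} of og = begin
    exp (f ⊕ g)                                           ≈⟨ exp-truncate (Ord-⊕ of og) ⟩
    Σ (γ (f ⊕ g)) (upTo (suc M))                          ≈⟨ Σ-cong (upTo (suc M)) (γ-⊕ f g) ⟩
    -- A product of the terms i and j has order at least i + j, hence is zero up to degree M once i
    -- + j > M.
    Σ (conv (γ f) (γ g)) (upTo (suc M))                   ≈⟨ Σ-conv M (γ f) (γ g) (λ i j M<i+j → Ord⇒≈0
                                                               (Ord-⊗ {f = γ f i} {γ g j} (Ord-⋆ (dividedPower 1 i) (Ord-↑ of i)) (Ord-⋆ (dividedPower 1 j) (Ord-↑ og j))) M<i+j) ⟩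
    Σ (γ f) (upTo (suc M)) ⊗ Σ (γ g) (upTo (suc M))       ≈⟨ ⊗-cong≋ (exp-truncate of) (exp-truncate og) ⟨
    exp f ⊗ exp g                                         ∎

  exp-cong : ∀ {f g : PS m} → Ord 1 f → Ord 1 g → f ≋ g → exp f ≋ exp g
  exp-cong of og f≋g = ≋-trans (exp-truncate of) (≋-trans
    (Σ-cong (upTo (suc M)) (λ k → ⋆-congˡ (dividedPower 1 k) (↑-cong f≋g k))) (≋-sym (exp-truncate og)))

  exp-≋0 : ∀ {f : PS m} → Ord 1 f → f ≋ 0ₛ → exp f ≋ 1ₛ
  exp-≋0 {f} o f≋0 = begin
    exp f                                                ≈⟨ exp-truncate o ⟩
    Σ (γ f) (upTo (suc M))                               ≡⟨ Σ-upTo-suc (γ f) M ⟩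
    γ f 0 ⊕ Σ (γ f ∘ suc) (upTo M)                       ≈⟨ ⊕-cong (1⋆ 1ₛ) (Σ-zero∈ (upTo M) (λ {k} _ → vanish k)) ⟩
    1ₛ ⊕ 0ₛ                                              ≈⟨ ⊕-identityʳ 1ₛ ⟩
    1ₛ                                                   ∎
    where
    vanish : ∀ k → γ f (suc k) ≋ 0ₛ
    vanish k = ≋-trans (⋆-congˡ (dividedPower 1 (suc k)) (≋-trans (⊗-cong≋ f≋0 (≋-refl {f ↑ k})) (⊗-zeroˡ≋ (f ↑ k))))
      (mk λ α _ → ℚₚ.*-zeroʳ (dividedPower 1 (suc k)))

  exp-• : ∀ {f : PS m} → Ord 1 f → ∀ k → exp f ↑ k ≋ exp (k • f)
  exp-• {f} o zero    = ≋-sym (exp-≋0 (Ord-⋆ ⟨ 0 ⟩ o) (mk λ α _ → ℚₚ.*-zeroˡ (f α)))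
  exp-• {f} o (suc k) = begin
    exp f ⊗ exp f ↑ k      ≈⟨ ⊗-congˡ (exp f) (exp-• o k) ⟩
    exp f ⊗ exp (k • f)    ≈⟨ exp-⊕ o (Ord-⋆ ⟨ k ⟩ o) ⟨
    exp (f ⊕ k • f)        ≈⟨ exp-cong (Ord-⊕ o (Ord-⋆ ⟨ k ⟩ o)) (Ord-⋆ ⟨ suc k ⟩ o) (≋-sym (suc-• k f)) ⟩
    exp (suc k • f)        ∎

  -- The link with bi-brackets: the coefficients of exp(vf) in powers of f are the factors v^k / k!
  -- occurring in their definition.
  exp-•-truncate : ∀ {f : PS m} → Ord 1 f → ∀ v →
                   exp (v • f) ≋ Σ (λ k → dividedPower v k ⋆ f ↑ k) (upTo (suc M))
  exp-•-truncate {f} o v = ≋-trans (exp-truncate (Ord-⋆ ⟨ v ⟩ o)) (Σ-cong (upTo (suc M)) λ k → begin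
    dividedPower 1 k ⋆ (v • f) ↑ k                ≈⟨ ⋆-congˡ (dividedPower 1 k) (•-↑ v f k) ⟩
    dividedPower 1 k ⋆ ⟨ v ℕ.^ k ⟩ ⋆ f ↑ k        ≈⟨ ⋆-⋆ (dividedPower 1 k) ⟨ v ℕ.^ k ⟩ (f ↑ k) ⟩
    (dividedPower 1 k * ⟨ v ℕ.^ k ⟩) ⋆ f ↑ k      ≈⟨ ⋆-congʳ (f ↑ k) (dividedPower-^ v k) ⟩
    dividedPower v k ⋆ f ↑ k                      ∎)

-- Variables and linear forms

sum-unit : (i : Fin m) → Vec.sum (Vec.replicate m 0 [ i ]≔ 1) ≡ 1
sum-unit {suc m} zero    = ≡.cong suc (sum-replicate-0 m)
  where
  sum-replicate-0 : ∀ m → Vec.sum (Vec.replicate m 0) ≡ 0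
  sum-replicate-0 zero    = ≡.refl
  sum-replicate-0 (suc m) = sum-replicate-0 m
sum-unit {suc m} (suc i) = sum-unit i

Ord-var : (i : Fin m) → Ord 1 (var i)
Ord-var i α |α|<1 with Vecₚ.≡-dec ℕ._≟_ (Vec.replicate _ 0 [ i ]≔ 1) α
... | no _       = ≡.refl
... | yes ≡.refl = contradiction (≡.subst (_< 1) (sum-unit i) |α|<1) (ℕₚ.n≮n 1)

Ord-weaken : ∀ {j k} {f : PS m} → j ≤ k → Ord k f → Ord j f
Ord-weaken j≤k o α |α|<j = o α (ℕₚ.<-≤-trans |α|<j j≤k)

lin : Vec ℕ l → Vector (PS m) l → PS m
lin []      C = 0ₛ
lin (w ∷ u) C = w • C zero ⊕ lin u (C ∘ suc)

Ord-lin : (u : Vec ℕ l) {C : Vector (PS m) l} → (∀ j → Ord 1 (C j)) → Ord 1 (lin u C)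
Ord-lin []      o α _ = ≡.refl
Ord-lin (w ∷ u) {C} o = Ord-⊕ {f = w • C zero} {lin u (C ∘ suc)} (Ord-⋆ ⟨ w ⟩ (o zero)) (Ord-lin u (o ∘ suc))

-- Index pairs of bounded weight

Positive : Vec ℕ l → Set
Positive = All (0 <_)

-- With positive multiplicities no part exceeds the size of the partition. This and its mirror image
-- leave only finitely many index pairs below a given weight.
lookup≤∙ˡ : (u v : Vec ℕ l) → Positive v → ∀ i → lookup u i ≤ u ∙ v
lookup≤∙ˡ (x ∷ u) (suc y ∷ v) (_ ∷ pv) zero    = ℕₚ.≤-trans (ℕₚ.m≤m*n x (suc y)) (ℕₚ.m≤m+n (x ℕ.* suc y) (u ∙ v))
lookup≤∙ˡ (x ∷ u) (y ∷ v)     (_ ∷ pv) (suc i) = ℕₚ.≤-trans (lookup≤∙ˡ u v pv i) (ℕₚ.m≤n+m (u ∙ v) (x ℕ.* y))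

∙-comm : (u v : Vec ℕ l) → u ∙ v ≡ v ∙ u
∙-comm []      []      = ≡.refl
∙-comm (x ∷ u) (y ∷ v) = ≡.cong₂ ℕ._+_ (ℕₚ.*-comm x y) (∙-comm u v)

lookup≤∙ʳ : (u v : Vec ℕ l) → Positive u → ∀ i → lookup v i ≤ u ∙ v
lookup≤∙ʳ u v pu i = ≡.subst (lookup v i ≤_) (∙-comm v u) (lookup≤∙ˡ v u pu i)

-- The entries run from 1 to N + 1, because the index 0, ..., N of a truncated geometric series
-- becomes the multiplicity one higher. Pairs that are too heavy may occur; their terms vanish up to
-- the degree considered.
posBox : ∀ l N → List (Vec ℕ l)
posBox l N = List.map (Vec.map suc) (box l N)

posBox-unique : ∀ l N → Unique (posBox l N)
posBox-unique l N = Uniqueₚ.map⁺ (map-suc-injective _ _) (box-unique l N)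
  where
  map-suc-injective : ∀ {l} (u v : Vec ℕ l) → Vec.map suc u ≡ Vec.map suc v → u ≡ v
  map-suc-injective []      []      eq = ≡.refl
  map-suc-injective (x ∷ u) (y ∷ v) eq =
    ≡.cong₂ _∷_ (ℕₚ.suc-injective (Vecₚ.∷-injectiveˡ eq)) (map-suc-injective u v (Vecₚ.∷-injectiveʳ eq))

∈-posBox⁺ : ∀ {N} {v : Vec ℕ l} → Positive v → (∀ i → lookup v i ≤ N) → v ∈ posBox l N
∈-posBox⁺ {l} {N} {v} pv v≤N = ≡.subst (_∈ posBox l N) (map-suc-pred v pv)
  (∈-map⁺ (Vec.map suc) (∈-box⁺ (Vec.map ℕ.pred v) λ i →
    ≡.subst (_≤ N) (≡.sym (Vecₚ.lookup-map i ℕ.pred v)) (ℕₚ.≤-trans ℕₚ.pred[n]≤n (v≤N i))))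
  where
  map-suc-pred : ∀ {l} (v : Vec ℕ l) → Positive v → Vec.map suc (Vec.map ℕ.pred v) ≡ v
  map-suc-pred []          []       = ≡.refl
  map-suc-pred (suc x ∷ v) (_ ∷ pv) = ≡.cong (suc x ∷_) (map-suc-pred v pv)

∈-posBox⁻ : ∀ {N} {v : Vec ℕ l} → v ∈ posBox l N → Positive v
∈-posBox⁻ v∈ with a , _ , ≡.refl ← ∈-map⁻ (Vec.map suc) v∈ = positive a
  where
  positive : ∀ {l} (a : Vec ℕ l) → Positive (Vec.map suc a)
  positive []      = []
  positive (x ∷ a) = s≤s z≤n ∷ positive a

Index : {l : ℕ} → Vec ℕ l × Vec ℕ l → Set
Index (u , v) = Decreasing⁺ u × Positive v

weight : Vec ℕ l × Vec ℕ l → ℕ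
weight (u , v) = u ∙ v

-- Grouped by weight, since the coefficients of T deliver the pairs separately for each power of q.
indices : ∀ l N → List (Vec ℕ l × Vec ℕ l)
indices l N = concat (List.map (biIndices l) (upTo (suc N)))

∈-biIndices⁻ : ∀ {N} {uv : Vec ℕ l × Vec ℕ l} → uv ∈ biIndices l N → Index uv × weight uv ≡ N
∈-biIndices⁻ {l} {N} uv∈ =
  let _ , du , pv , eq = ∈-filter⁻ (λ (u , v) → decreasing⁺? u ×-dec (all? (0 ℕₚ.<?_) v ×-dec (u ∙ v ℕ.≟ N)))
                           {xs = cartesianProduct (box l N) (box l N)} uv∈
  in (du , pv) , eq

∈-biIndices⁺ : ∀ {uv : Vec ℕ l × Vec ℕ l} → Index uv → uv ∈ biIndices l (weight uv)
∈-biIndices⁺ {uv = u , v} (du , pv) =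
  ∈-filter⁺ (λ (u′ , v′) → decreasing⁺? u′ ×-dec (all? (0 ℕₚ.<?_) v′ ×-dec (u′ ∙ v′ ℕ.≟ u ∙ v)))
    (∈-cartesianProduct⁺ (∈-box⁺ u (lookup≤∙ˡ u v pv)) (∈-box⁺ v (lookup≤∙ʳ u v (proj₂ du))))
    (du , pv , ≡.refl)

indices-unique : ∀ l N → Unique (indices l N)
indices-unique l N = Uniqueₚ.concat⁺
  (Listᴬₚ.map⁺ (Listᴬ.tabulate λ {k} _ → Uniqueₚ.filter⁺ _ (Uniqueₚ.cartesianProduct⁺ (box-unique l k) (box-unique l k))))
  (AllPairsₚ.map⁺ (AllPairs.map disjoint (Uniqueₚ.upTo⁺ (suc N))))
  where
  disjoint : ∀ {i j} → i ≢ j → Disjoint (biIndices l i) (biIndices l j)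
  disjoint i≢j (uv∈i , uv∈j) = i≢j (≡.trans (≡.sym (proj₂ (∈-biIndices⁻ uv∈i))) (proj₂ (∈-biIndices⁻ uv∈j)))

∈-indices⁺ : ∀ {N} {uv : Vec ℕ l × Vec ℕ l} → Index uv → weight uv ≤ N → uv ∈ indices l N
∈-indices⁺ {l} i w≤N = ∈-concat⁺′ (∈-biIndices⁺ i) (∈-map⁺ (biIndices l) (∈-upTo⁺ (s≤s w≤N)))

∈-indices⁻ : ∀ {N} {uv : Vec ℕ l × Vec ℕ l} → uv ∈ indices l N → Index uv × weight uv ≤ N
∈-indices⁻ {l} {N} uv∈
  with _ , uv∈xs , xs∈ ← ∈-concat⁻′ (List.map (biIndices l) (upTo (suc N))) uv∈
  with k , k∈ , ≡.refl ← ∈-map⁻ (biIndices l) xs∈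
  with i , ≡.refl ← ∈-biIndices⁻ uv∈xs = i , ℕₚ.≤-pred (∈-upTo⁻ k∈)

-- Coefficients of the generating series

∏ℚ : Vector ℚ l → ℚ
∏ℚ = F.foldr _*_ 1ℚ

∏ℚ-cong : {f g : Vector ℚ l} → (∀ j → f j ≡ g j) → ∏ℚ f ≡ ∏ℚ g
∏ℚ-cong {zero}  p = ≡.refl
∏ℚ-cong {suc l} p = ≡.cong₂ _*_ (p zero) (∏ℚ-cong (p ∘ suc))

∏ℚ-* : (f g : Vector ℚ l) → ∏ℚ (λ j → f j * g j) ≡ ∏ℚ f * ∏ℚ g
∏ℚ-* {zero}  f g = ≡.refl
∏ℚ-* {suc l} f g = ≡.trans (≡.cong ((f zero * g zero) *_) (∏ℚ-* (f ∘ suc) (g ∘ suc)))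
  (interchange (f zero) (g zero) (∏ℚ (f ∘ suc)) (∏ℚ (g ∘ suc)))
  where open import Algebra.Properties.CommutativeSemigroup
          (CommutativeSemiring.*-commutativeSemigroup ℚ-semiring) using (interchange)

productℚ-allFin : (f : Fin l → ℚ) → productℚ (List.map f (List.allFin l)) ≡ ∏ℚ f
productℚ-allFin {l} f = ≡.trans (≡.cong productℚ (Listₚ.map-tabulate id f)) (tabulated f)
  where
  tabulated : ∀ {l} (f : Fin l → ℚ) → productℚ (List.tabulate f) ≡ ∏ℚ f
  tabulated {zero}  f = ≡.refl
  tabulated {suc l} f = ≡.cong (f zero *_) (tabulated (f ∘ suc))

dividedPowers : Vec ℕ l → Vec ℕ l → ℚ
dividedPowers w a = ∏ℚ (λ j → dividedPower (lookup w j) (lookup a j))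

-- For a fixed pair the summand separates into a factor in the X-exponents `a`, paired with v, and a
-- factor in the Y-exponents `b`, paired with u. This lets the sum over all exponents split into two
-- exponentials. The shift s = a + 1 cancels against the s - 1 of the bi-bracket.
T-coefficient : ∀ N (a b : Vec ℕ l) →
  T l (N ∷ (a Vec.++ b)) ≡ Σℚ.Σ (λ (u , v) → dividedPowers v a * dividedPowers u b) (biIndices l N)
T-coefficient {l} N a b = Σℚ.Σ-cong (biIndices l N) λ (u , v) → begin
  productℚ (List.map (factor u v) (List.allFin l)) ≡⟨ productℚ-allFin (factor u v) ⟩
  ∏ℚ (factor u v)                                  ≡⟨ ∏ℚ-cong (λ j → ≡.cong₂ _*_
                                                        (≡.cong (λ z → dividedPower (lookup u j) (lookup z j)) drop≡b)
                                                        (≡.cong (dividedPower (lookup v j)) (exponent j))) ⟩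
  ∏ℚ (λ j → dividedPower (lookup u j) (lookup b j) * dividedPower (lookup v j) (lookup a j))
                                                   ≡⟨ ∏ℚ-* (λ j → dividedPower (lookup u j) (lookup b j)) _ ⟩
  dividedPowers u b * dividedPowers v a            ≡⟨ ℚₚ.*-comm (dividedPowers u b) _ ⟩
  dividedPowers v a * dividedPowers u b            ∎
  where
  open ≡-Reasoning
  s r : Vec ℕ l
  s = Vec.map suc (Vec.take l (a Vec.++ b))
  r = Vec.drop l (a Vec.++ b)
  factor : Vec ℕ l → Vec ℕ l → Fin l → ℚ
  factor u v j = dividedPower (lookup u j) (lookup r j) * dividedPower (lookup v j) (lookup s j ∸ 1)
  take≡a : Vec.take l (a Vec.++ b) ≡ a
  take≡a = Vecₚ.++-injectiveˡ _ _ (Vecₚ.take++drop≡id l (a Vec.++ b))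
  drop≡b : r ≡ b
  drop≡b = Vecₚ.++-injectiveʳ (Vec.take l (a Vec.++ b)) a (Vecₚ.take++drop≡id l (a Vec.++ b))
  exponent : ∀ j → lookup s j ∸ 1 ≡ lookup a j
  exponent j = ≡.trans (≡.cong (_∸ 1) (Vecₚ.lookup-map j suc (Vec.take l (a Vec.++ b)))) (≡.cong (λ z → lookup z j) take≡a)

_≟ᵢ_ : DecidableEquality (Vec ℕ l × Vec ℕ l)
_≟ᵢ_ = Productₚ.≡-dec (Vecₚ.≡-dec ℕ._≟_) (Vecₚ.≡-dec ℕ._≟_)

-- Expansion of products and of T into the terms W

W : (A B : Vector (PS (suc m)) l) → Vec ℕ l × Vec ℕ l → PS (suc m)
W A B (u , v) = q ↑ (u ∙ v) ⊗ (exp (lin u B) ⊗ exp (lin v A))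

module _ {m M : ℕ} where
  open Truncated (suc m) M
  open import Relation.Binary.Reasoning.Setoid ≋-setoid

  ∏-exp : (w : Vec ℕ l) {C : Vector (PS (suc m)) l} → (∀ j → Ord 1 (C j)) →
          ∏ (λ j → exp (lookup w j • C j)) ≋ exp (lin w C)
  ∏-exp []      o = ≋-sym (exp-≋0 (λ _ _ → ≡.refl) ≋-refl)
  ∏-exp (x ∷ w) {C} o = begin
    exp (x • C zero) ⊗ ∏ (λ j → exp (lookup w j • C (suc j))) ≈⟨ ⊗-congˡ (exp (x • C zero)) (∏-exp w (o ∘ suc)) ⟩
    exp (x • C zero) ⊗ exp (lin w (C ∘ suc))                  ≈⟨ exp-⊕ (Ord-⋆ ⟨ x ⟩ (o zero)) (Ord-lin w (o ∘ suc)) ⟨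
    exp (lin (x ∷ w) C)                                       ∎

  ∏-q : (u v : Vec ℕ l) → ∏ (λ j → q ↑ (lookup u j ℕ.* lookup v j)) ≋ q ↑ (u ∙ v)
  ∏-q []      []      = ≋-refl
  ∏-q (x ∷ u) (y ∷ v) = begin
    q ↑ (x ℕ.* y) ⊗ ∏ (λ j → q ↑ (lookup u j ℕ.* lookup v j)) ≈⟨ ⊗-congˡ (q ↑ (x ℕ.* y)) (∏-q u v) ⟩
    q ↑ (x ℕ.* y) ⊗ q ↑ (u ∙ v)                               ≈⟨ ↑-+ q (x ℕ.* y) (u ∙ v) ⟨
    q ↑ ((x ∷ u) ∙ (y ∷ v))                                   ∎

  L-truncate : ∀ {k} {f : PS (suc m)} → 1 ≤ k → Ord 1 f →
    L k f ≋ Σ (λ j → exp (suc j • f) ⊗ q ↑ (k ℕ.* suc j)) (upTo (suc M))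
  L-truncate {k} {f} 1≤k o = begin
    x ⊗ inverse (1ₛ ⊖ x)                                        ≈⟨ ⊗-congˡ x (inverse-1⊖ Ord-x) ⟩
    x ⊗ Σ (x ↑_) (upTo (suc M))                                 ≈⟨ *-Σ x (x ↑_) (upTo (suc M)) ⟩
    Σ (λ j → x ↑ suc j) (upTo (suc M))                          ≈⟨ Σ-cong (upTo (suc M)) (λ j → ≋-trans (↑-⊗ (exp f) (q ↑ k) (suc j))
                                                                     (⊗-cong≋ (exp-• o (suc j)) (↑-* q k (suc j)))) ⟩
    Σ (λ j → exp (suc j • f) ⊗ q ↑ (k ℕ.* suc j)) (upTo (suc M)) ∎
    where
    x = exp f ⊗ q ↑ k
    -- The exponential has constant term 1, so the positive order has to come from `q ↑ k`; this is
    -- where k ≥ 1 is needed.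
    Ord-x : Ord 1 x
    Ord-x = Ord-⊗ {f = exp f} {q ↑ k} (Ord-0 (exp f)) (Ord-weaken 1≤k (Ord-↑ (Ord-var zero) k))

  ∏EL-truncate : {A B : Vector (PS (suc m)) l} → (∀ j → Ord 1 (A j)) → (∀ j → Ord 1 (B j)) →
    (u : Vec ℕ l) → Positive u →
    ∏ (λ j → E (lookup u j) (B j) ⊗ L (lookup u j) (A j)) ≋ Σ (λ v → W A B (u , v)) (posBox l M)
  ∏EL-truncate {l} {A} {B} oA oB u pu = begin
    ∏ (λ j → E (lookup u j) (B j) ⊗ L (lookup u j) (A j))
      ≈⟨ ∏-cong (λ j → ≋-trans (⊗-congˡ (E (lookup u j) (B j)) (L-truncate (Vecᴬₚ.lookup⁺ pu j) (oA j)))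
                               (*-Σ (E (lookup u j) (B j)) _ (upTo (suc M)))) ⟩
    ∏ (λ j → Σ (λ k → h j (suc k)) (upTo (suc M)))
      -- Choosing one term from each of the l geometric series amounts to choosing a vector of
      -- multiplicities.
      ≈⟨ ∏-Σ (λ j k → h j (suc k)) M ⟩
    Σ (λ a → ∏ (λ j → h j (suc (lookup a j)))) (box l M)
      ≈⟨ Σ-cong (box l M) (λ a → ≋-trans
           (∏-cong (λ j → ≋-reflexive (≡.cong (h j) (≡.sym (Vecₚ.lookup-map j suc a)))))
           (term (Vec.map suc a))) ⟩
    Σ (λ a → W A B (u , Vec.map suc a)) (box l M)
      ≡⟨ Σ-map (λ v → W A B (u , v)) (Vec.map suc) (box l M) ⟨
    Σ (λ v → W A B (u , v)) (posBox l M) ∎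
    where
    h : Fin l → ℕ → PS (suc m)
    h j k = exp (lookup u j • B j) ⊗ (exp (k • A j) ⊗ q ↑ (lookup u j ℕ.* k))

    term : ∀ v → ∏ (λ j → h j (lookup v j)) ≋ W A B (u , v)
    term v = begin
      ∏ (λ j → h j (lookup v j))
        ≈⟨ ∏-⊗ (λ j → exp (lookup u j • B j)) (λ j → exp (lookup v j • A j) ⊗ q ↑ (lookup u j ℕ.* lookup v j)) ⟩
      ∏ (λ j → exp (lookup u j • B j)) ⊗ ∏ (λ j → exp (lookup v j • A j) ⊗ q ↑ (lookup u j ℕ.* lookup v j))
        ≈⟨ ⊗-cong≋ (∏-exp u oB) (≋-trans (∏-⊗ (λ j → exp (lookup v j • A j)) (λ j → q ↑ (lookup u j ℕ.* lookup v j)))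
                                          (⊗-cong≋ (∏-exp v oA) (∏-q u v))) ⟩
      exp (lin u B) ⊗ (exp (lin v A) ⊗ q ↑ (u ∙ v))
        ≈⟨ solve 3 (λ x y z → x :* (y :* z) := z :* (x :* y)) ≋-refl (exp (lin u B)) (exp (lin v A)) (q ↑ (u ∙ v)) ⟩
      W A B (u , v) ∎

  W-vanish : (A B : Vector (PS (suc m)) l) → ∀ uv → M < weight uv → W A B uv ≋ 0ₛ
  W-vanish A B (u , v) M<w = Ord⇒≈0 (Ord-⊗ˡ {f = q ↑ (u ∙ v)} (exp (lin u B) ⊗ exp (lin v A)) (Ord-↑ (Ord-var zero) (u ∙ v))) M<w

  Σ-box-++ : ∀ j k (h : Vec ℕ (j ℕ.+ k) → PS (suc m)) N →
             Σ h (box (j ℕ.+ k) N) ≋ Σ (λ a → Σ (λ b → h (a Vec.++ b)) (box k N)) (box j N)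
  Σ-box-++ zero    k h N = ≋-sym (⊕-identityʳ (Σ h (box k N)))
  Σ-box-++ (suc j) k h N = begin
    Σ h (box (suc j ℕ.+ k) N)
      ≈⟨ Σ-cartesianProductWith h _∷_ (upTo (suc N)) (box (j ℕ.+ k) N) ⟩
    Σ (λ i → Σ (λ ab → h (i ∷ ab)) (box (j ℕ.+ k) N)) (upTo (suc N))
      ≈⟨ Σ-cong (upTo (suc N)) (λ i → Σ-box-++ j k (λ ab → h (i ∷ ab)) N) ⟩
    Σ (λ i → Σ (λ a → Σ (λ b → h (i ∷ (a Vec.++ b))) (box k N)) (box j N)) (upTo (suc N))
      ≈⟨ Σ-cartesianProductWith (λ a → Σ (λ b → h (a Vec.++ b)) (box k N)) _∷_ (upTo (suc N)) (box j N) ⟨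
    Σ (λ a → Σ (λ b → h (a Vec.++ b)) (box k N)) (box (suc j) N) ∎

  ∏-++ : ∀ j k (D : Vector (PS (suc m)) (j ℕ.+ k)) →
         ∏ D ≋ ∏ (λ i → D (i ↑ˡ k)) ⊗ ∏ (λ i → D (j ↑ʳ i))
  ∏-++ zero    k D = ≋-sym (⊗-identityˡ (∏ D))
  ∏-++ (suc j) k D = ≋-trans (⊗-congˡ (D zero) (∏-++ j k (D ∘ suc)))
    (≋-sym (⊗-assoc (D zero) (∏ (λ i → D (suc i ↑ˡ k))) (∏ (λ i → D (suc j ↑ʳ i)))))

  -- The exponents are summed independently, so the sum over the box is a product of l truncated
  -- exponential series, and the product of the exponentials is the exponential of the linear form.
  Σ-dividedPowers : (w : Vec ℕ l) {C : Vector (PS (suc m)) l} → (∀ j → Ord 1 (C j)) →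
    Σ (λ a → dividedPowers w a ⋆ ∏ (λ j → C j ↑ lookup a j)) (box l M) ≋ exp (lin w C)
  Σ-dividedPowers {l} w {C} o = begin
    Σ (λ a → dividedPowers w a ⋆ ∏ (λ j → C j ↑ lookup a j)) (box l M)
      ≈⟨ Σ-cong (box l M) (λ a → ∏-⋆ (λ j → dividedPower (lookup w j) (lookup a j)) (λ j → C j ↑ lookup a j)) ⟨
    Σ (λ a → ∏ (λ j → dividedPower (lookup w j) (lookup a j) ⋆ C j ↑ lookup a j)) (box l M)
      ≈⟨ ∏-Σ (λ j k → dividedPower (lookup w j) k ⋆ C j ↑ k) M ⟨
    ∏ (λ j → Σ (λ k → dividedPower (lookup w j) k ⋆ C j ↑ k) (upTo (suc M)))
      ≈⟨ ∏-cong (λ j → exp-•-truncate (o j) (lookup w j)) ⟨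
    ∏ (λ j → exp (lookup w j • C j))
      ≈⟨ ∏-exp w o ⟩
    exp (lin w C) ∎

module _ {l M : ℕ} {A B : Vector (Series l) l} (oA : ∀ j → Ord 1 (A j)) (oB : ∀ j → Ord 1 (B j)) where
  open Truncated (suc (l ℕ.+ l)) M
  open import Relation.Binary.Reasoning.Setoid ≋-setoid

  private
    D : Vector (Series l) (suc (l ℕ.+ l))
    D = q F.∷ (A F.++ B)

    Ord-D : ∀ i → Ord 1 (D i)
    Ord-D zero    = Ord-var zero
    Ord-D (suc i) with splitAt l i
    ... | inj₁ j = oA j
    ... | inj₂ j = oB j

    A^ B^ : Vec ℕ l → Series l
    A^ a = ∏ (λ j → A j ↑ lookup a j)
    B^ b = ∏ (λ j → B j ↑ lookup b j)

    D^ : ∀ N a b → ∏ (λ i → D i ↑ lookup (N ∷ (a Vec.++ b)) i) ≋ q ↑ N ⊗ (A^ a ⊗ B^ b)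
    D^ N a b = ⊗-congˡ (q ↑ N) (≋-trans (∏-++ l l (λ i → (A F.++ B) i ↑ lookup (a Vec.++ b) i)) (⊗-cong≋
      (∏-cong (λ i → ≋-reflexive (≡.cong₂ _↑_ (Fₚ.lookup-++ˡ A B i) (Vecₚ.lookup-++ˡ a b i))))
      (∏-cong (λ i → ≋-reflexive (≡.cong₂ _↑_ (Fₚ.lookup-++ʳ A B i) (Vecₚ.lookup-++ʳ a b i))))))

    term : ℕ → Vec ℕ l → Vec ℕ l → Vec ℕ l × Vec ℕ l → Series l
    term N a b (u , v) = (dividedPowers v a * dividedPowers u b) ⋆ (q ↑ N ⊗ (A^ a ⊗ B^ b))

    Σ-term : ∀ N u v → Σ (λ a → Σ (λ b → term N a b (u , v)) (box l M)) (box l M) ≋ q ↑ N ⊗ (exp (lin u B) ⊗ exp (lin v A))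
    Σ-term N u v = begin
      Σ (λ a → Σ (λ b → term N a b (u , v)) (box l M)) (box l M)
        ≈⟨ Σ-cong (box l M) (λ a → Σ-cong (box l M) (λ b → ≋-trans
             (≋-sym (⊗-⋆ (dividedPowers v a * dividedPowers u b) (q ↑ N) (A^ a ⊗ B^ b)))
             (⊗-congˡ (q ↑ N) (≋-sym (⋆-⊗-⋆ (dividedPowers v a) (dividedPowers u b) (A^ a) (B^ b)))))) ⟩
      Σ (λ a → Σ (λ b → q ↑ N ⊗ ((dividedPowers v a ⋆ A^ a) ⊗ (dividedPowers u b ⋆ B^ b))) (box l M)) (box l M)
        ≈⟨ Σ-cong (box l M) (λ a → *-Σ (q ↑ N) (λ b → (dividedPowers v a ⋆ A^ a) ⊗ (dividedPowers u b ⋆ B^ b)) (box l M)) ⟨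
      Σ (λ a → q ↑ N ⊗ Σ (λ b → (dividedPowers v a ⋆ A^ a) ⊗ (dividedPowers u b ⋆ B^ b)) (box l M)) (box l M)
        ≈⟨ *-Σ (q ↑ N) (λ a → Σ (λ b → (dividedPowers v a ⋆ A^ a) ⊗ (dividedPowers u b ⋆ B^ b)) (box l M)) (box l M) ⟨
      q ↑ N ⊗ Σ (λ a → Σ (λ b → (dividedPowers v a ⋆ A^ a) ⊗ (dividedPowers u b ⋆ B^ b)) (box l M)) (box l M)
        ≈⟨ ⊗-congˡ (q ↑ N) (Σ-*-Σ (λ a → dividedPowers v a ⋆ A^ a) (λ b → dividedPowers u b ⋆ B^ b) (box l M) (box l M)) ⟨
      q ↑ N ⊗ (Σ (λ a → dividedPowers v a ⋆ A^ a) (box l M) ⊗ Σ (λ b → dividedPowers u b ⋆ B^ b) (box l M))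
        ≈⟨ ⊗-congˡ (q ↑ N) (⊗-cong≋ (Σ-dividedPowers v oA) (Σ-dividedPowers u oB)) ⟩
      q ↑ N ⊗ (exp (lin v A) ⊗ exp (lin u B))
        ≈⟨ ⊗-congˡ (q ↑ N) (⊗-comm (exp (lin v A)) (exp (lin u B))) ⟩
      q ↑ N ⊗ (exp (lin u B) ⊗ exp (lin v A)) ∎

    coefficient : ∀ N → Σ (λ ab → T l (N ∷ ab) ⋆ ∏ (λ i → D i ↑ lookup (N ∷ ab) i)) (box (l ℕ.+ l) M)
                        ≋ Σ (W A B) (biIndices l N)
    coefficient N = begin
      Σ (λ ab → T l (N ∷ ab) ⋆ ∏ (λ i → D i ↑ lookup (N ∷ ab) i)) (box (l ℕ.+ l) M)
        ≈⟨ Σ-box-++ l l (λ ab → T l (N ∷ ab) ⋆ ∏ (λ i → D i ↑ lookup (N ∷ ab) i)) M ⟩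
      Σ (λ a → Σ (λ b → T l (N ∷ (a Vec.++ b)) ⋆ ∏ (λ i → D i ↑ lookup (N ∷ (a Vec.++ b)) i)) (box l M)) (box l M)
        ≈⟨ Σ-cong (box l M) (λ a → Σ-cong (box l M) (λ b → expand a b)) ⟩
      Σ (λ a → Σ (λ b → Σ (term N a b) (biIndices l N)) (box l M)) (box l M)
        -- The pairs (u , v) are moved outside, so that for each pair the exponents of A and of B
        -- can be summed freely.
        ≈⟨ Σ-cong (box l M) (λ a → Σ-swap (term N a) (box l M) (biIndices l N)) ⟩
      Σ (λ a → Σ (λ uv → Σ (λ b → term N a b uv) (box l M)) (biIndices l N)) (box l M)
        ≈⟨ Σ-swap (λ a uv → Σ (λ b → term N a b uv) (box l M)) (box l M) (biIndices l N) ⟩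
      Σ (λ uv → Σ (λ a → Σ (λ b → term N a b uv) (box l M)) (box l M)) (biIndices l N)
        -- For the pairs listed here N is the weight, which turns `q ↑ N` into the power of q in
        -- `W`.
        ≈⟨ Σ-cong∈ (biIndices l N) (λ {(u , v)} uv∈ → ≋-trans (Σ-term N u v)
             (≋-reflexive (≡.cong (λ k → q ↑ k ⊗ (exp (lin u B) ⊗ exp (lin v A))) (≡.sym (proj₂ (∈-biIndices⁻ uv∈)))))) ⟩
      Σ (W A B) (biIndices l N) ∎
      where
      expand : ∀ a b → T l (N ∷ (a Vec.++ b)) ⋆ ∏ (λ i → D i ↑ lookup (N ∷ (a Vec.++ b)) i) ≋ Σ (term N a b) (biIndices l N)
      expand a b = begin
        T l (N ∷ (a Vec.++ b)) ⋆ ∏ (λ i → D i ↑ lookup (N ∷ (a Vec.++ b)) i)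
          ≈⟨ ⋆-congˡ (T l (N ∷ (a Vec.++ b))) (D^ N a b) ⟩
        T l (N ∷ (a Vec.++ b)) ⋆ (q ↑ N ⊗ (A^ a ⊗ B^ b))
          ≈⟨ ⋆-congʳ (q ↑ N ⊗ (A^ a ⊗ B^ b)) (T-coefficient N a b) ⟩
        Σℚ.Σ (λ (u , v) → dividedPowers v a * dividedPowers u b) (biIndices l N) ⋆ (q ↑ N ⊗ (A^ a ⊗ B^ b))
          ≈⟨ Σ-⋆ (λ (u , v) → dividedPowers v a * dividedPowers u b) (q ↑ N ⊗ (A^ a ⊗ B^ b)) (biIndices l N) ⟨
        Σ (term N a b) (biIndices l N) ∎

  T⟨⟩-indices : T⟨ A , B ⟩ ≋ Σ (W A B) (indices l M)
  T⟨⟩-indices = begin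
    T l ⟦ D ⟧
      ≈⟨ ⟦⟧-truncate (T l) D Ord-D ⟩
    Σ (λ α → T l α ⋆ ∏ (λ i → D i ↑ lookup α i)) (box (suc (l ℕ.+ l)) M)
      ≈⟨ Σ-cartesianProductWith (λ α → T l α ⋆ ∏ (λ i → D i ↑ lookup α i)) _∷_ (upTo (suc M)) (box (l ℕ.+ l) M) ⟩
    Σ (λ N → Σ (λ ab → T l (N ∷ ab) ⋆ ∏ (λ i → D i ↑ lookup (N ∷ ab) i)) (box (l ℕ.+ l) M)) (upTo (suc M))
      ≈⟨ Σ-cong (upTo (suc M)) coefficient ⟩
    Σ (λ N → Σ (W A B) (biIndices l N)) (upTo (suc M))
      ≡⟨ Σ-map (Σ (W A B)) (biIndices l) (upTo (suc M)) ⟨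
    Σ (Σ (W A B)) (List.map (biIndices l) (upTo (suc M)))
      ≈⟨ Σ-concat (W A B) (List.map (biIndices l) (upTo (suc M))) ⟨
    Σ (W A B) (indices l M) ∎

  -- Pairs of weight above M contribute nothing up to degree M, so any repetition-free list of index
  -- pairs serves if it misses none of weight at most M. This freedom allows an enumeration by u
  -- with independent v, and the two enumerations related by conjugation.
  T⟨⟩-exhaust : ∀ {S} → Unique S → (∀ {uv} → uv ∈ S → Index uv) →
                (∀ {uv} → Index uv → weight uv ≤ M → uv ∈ S) → T⟨ A , B ⟩ ≋ Σ (W A B) S
  T⟨⟩-exhaust uS S⊆ ⊆S = ≋-trans T⟨⟩-indices (Σ-unique _≟ᵢ_ (W A B) (indices-unique l M) uS
    (λ uv∈ uv∉ → let i , w≤M = ∈-indices⁻ uv∈ in contradiction (⊆S i w≤M) uv∉)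
    (λ {uv} uv∈ uv∉ → W-vanish A B uv (ℕₚ.≰⇒> λ w≤M → uv∉ (∈-indices⁺ (S⊆ uv∈) w≤M))))

-- At a monomial α of degree M the decreasing u with entries at most M suffice: any other u has an
-- entry above M, so all its pairs have weight above M. Keeping A and B general covers both sums of
-- the theorem at once.
T⟨⟩-isSum : {A B : Vector (Series l) l} → (∀ j → Ord 1 (A j)) → (∀ j → Ord 1 (B j)) →
  IsSum Decreasing⁺ (λ (u : Vec ℕ l) → ∏ (λ j → E (lookup u j) (B j) ⊗ L (lookup u j) (A j))) T⟨ A , B ⟩
T⟨⟩-isSum {l} {A} {B} oA oB α =
  S , Uniqueₚ.filter⁺ decreasing⁺? (box-unique l M) , Listᴬₚ.all-filter decreasing⁺? (box l M) ,
  (λ u du u∉S → ≋-trans (∏EL-truncate oA oB u (proj₂ du)) (Σ-zero∈ (posBox l M) (λ {v} v∈ →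
    W-vanish A B (u , v) (heavy du (∈-posBox⁻ v∈) u∉S))) .at α ℕₚ.≤-refl) ,
  ≡.trans (≡.sym (Σ-apply F S α)) (total .at α ℕₚ.≤-refl)
  where
  M = Vec.sum α
  open Truncated (suc (l ℕ.+ l)) M
  open import Relation.Binary.Reasoning.Setoid ≋-setoid
  S = filter decreasing⁺? (box l M)
  F : Vec ℕ l → Series l
  F u = ∏ (λ j → E (lookup u j) (B j) ⊗ L (lookup u j) (A j))

  heavy : ∀ {u v} → Decreasing⁺ u → Positive v → u ∉ S → M < u ∙ v
  heavy {u} {v} du pv u∉S = ℕₚ.≰⇒> λ w≤M →
    u∉S (∈-filter⁺ decreasing⁺? (∈-box⁺ u λ i → ℕₚ.≤-trans (lookup≤∙ˡ u v pv i) w≤M) du)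

  total : Σ F S ≋ T⟨ A , B ⟩
  total = begin
    Σ F S
      ≈⟨ Σ-cong∈ S (λ {u} u∈ → ∏EL-truncate oA oB u (proj₂ (proj₂ (∈-filter⁻ decreasing⁺? {xs = box l M} u∈)))) ⟩
    Σ (λ u → Σ (λ v → W A B (u , v)) (posBox l M)) S
      ≈⟨ Σ-cartesianProductWith (W A B) _,_ S (posBox l M) ⟨
    Σ (W A B) (cartesianProduct S (posBox l M))
      ≈⟨ T⟨⟩-exhaust oA oB
           (Uniqueₚ.cartesianProduct⁺ (Uniqueₚ.filter⁺ decreasing⁺? (box-unique l M)) (posBox-unique l M))
           (λ uv∈ → let u∈ , v∈ = ∈-cartesianProduct⁻ S (posBox l M) uv∈ in
             proj₂ (∈-filter⁻ decreasing⁺? {xs = box l M} u∈) , ∈-posBox⁻ v∈)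
           (λ {(u , v)} (du , pv) w≤M → ∈-cartesianProduct⁺
             (∈-filter⁺ decreasing⁺? (∈-box⁺ u λ i → ℕₚ.≤-trans (lookup≤∙ˡ u v pv i) w≤M) du)
             (∈-posBox⁺ pv λ i → ℕₚ.≤-trans (lookup≤∙ʳ u v (proj₂ du) i) w≤M)) ⟨
    T⟨ A , B ⟩ ∎

-- Substituting the variables for themselves

-- The inclusion of the series that do not involve the first variable; with it monomials are built
-- up one variable at a time.
embed : PS m → PS (suc m)
embed f (zero  ∷ α) = f α
embed f (suc _ ∷ α) = 0ℚ

embed-⊗ : (f g : PS m) → embed f ⊗ embed g ≈ embed (f ⊗ g)
embed-⊗ {m} f g (zero ∷ α)  = slice-⊗ (embed f) (embed g) 0 α
embed-⊗ {m} f g (suc k ∷ α) = ≡.trans (slice-⊗ (embed f) (embed g) (suc k) α)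
  (≡.cong₂ _+_ (CommutativeSemiring.zeroʳ (PS-semiring m) f α)
    (Convolution.conv-zeroˡ (PS-semiring m) {b = slice (embed g)} (λ _ _ → ≡.refl) k α))

embed-1 : 1ₛ ≈ embed {m} 1ₛ
embed-1 (zero  ∷ α) = ≡.refl
embed-1 (suc _ ∷ α) = ≡.refl

embed-var : (i : Fin m) → var (suc i) ≈ embed (var i)
embed-var i (zero  ∷ α) = ≡.refl
embed-var i (suc _ ∷ α) = ≡.refl

embed-cong : {f g : PS m} → f ≈ g → embed f ≈ embed g
embed-cong p (zero  ∷ α) = p α
embed-cong p (suc _ ∷ α) = ≡.refl

embed-var-↑ : ∀ (i : Fin m) k → var (suc i) ↑ k ≈ embed (var i ↑ k)
embed-var-↑ i zero    α = embed-1 α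
embed-var-↑ i (suc k) α = ≡.trans (⊗-cong (embed-var i) (embed-var-↑ i k) α) (embed-⊗ (var i) (var i ↑ k) α)

embed-∏ : (f : Vector (PS (suc m)) l) (g : Vector (PS m) l) → (∀ i → f i ≈ embed (g i)) → ∏ f ≈ embed (∏ g)
embed-∏ {l = zero}  f g p α = embed-1 α
embed-∏ {l = suc l} f g p α = ≡.trans (⊗-cong (p zero) (embed-∏ (f ∘ suc) (g ∘ suc) (p ∘ suc)) α)
  (embed-⊗ (g zero) (∏ (g ∘ suc)) α)

q-⊗-zero : ∀ (f : PS (suc m)) α → (q ⊗ f) (0 ∷ α) ≡ 0ℚ
q-⊗-zero {m} f α = ≡.trans (slice-⊗ q f 0 α) (⊗-zeroˡ (slice f 0) α)

-- The slices of `q` are 0 followed by the slices of `1ₛ`, so multiplying by `q` delays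
-- multiplication by one by a single step. Here `q` stands for whichever variable comes first.
q-⊗-suc : ∀ (f : PS (suc m)) k α → (q ⊗ f) (suc k ∷ α) ≡ f (k ∷ α)
q-⊗-suc {m} f k α = begin
  (q ⊗ f) (suc k ∷ α)                                        ≡⟨ slice-⊗ q f (suc k) α ⟩
  (0ₛ ⊗ slice f (suc k)) α + conv (slice 1ₛ) (slice f) k α   ≡⟨ ≡.cong₂ _+_ (⊗-zeroˡ (slice f (suc k)) α) (≡.sym (slice-⊗ 1ₛ f k α)) ⟩
  0ℚ + (1ₛ ⊗ f) (k ∷ α)                                      ≡⟨ ℚₚ.+-identityˡ _ ⟩
  (1ₛ ⊗ f) (k ∷ α)                                           ≡⟨ CommutativeSemiring.*-identityˡ (PS-semiring (suc m)) f (k ∷ α) ⟩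
  f (k ∷ α)                                                  ∎
  where
  open ≡-Reasoning
  open Convolution (PS-semiring m) using (conv)

q↑-⊗-embed : ∀ a (α : Vec ℕ m) → q ↑ a ⊗ embed (monomial α) ≈ monomial (a ∷ α)
q↑-⊗-embed {m} zero α (zero  ∷ β) = CommutativeSemiring.*-identityˡ (PS-semiring (suc m)) (embed (monomial α)) (zero ∷ β)
q↑-⊗-embed {m} zero α (suc k ∷ β) = CommutativeSemiring.*-identityˡ (PS-semiring (suc m)) (embed (monomial α)) (suc k ∷ β)
q↑-⊗-embed {m} (suc a) α (k ∷ β) = ≡.trans
  (CommutativeSemiring.*-assoc (PS-semiring (suc m)) q (q ↑ a) (embed (monomial α)) (k ∷ β)) (shifted k)
  where
  shifted : ∀ k → (q ⊗ (q ↑ a ⊗ embed (monomial α))) (k ∷ β) ≡ monomial (suc a ∷ α) (k ∷ β)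
  shifted zero    = q-⊗-zero (q ↑ a ⊗ embed (monomial α)) β
  shifted (suc k) = ≡.trans (q-⊗-suc (q ↑ a ⊗ embed (monomial α)) k β) (q↑-⊗-embed a α (k ∷ β))

-- Peeling off the first variable leaves, by induction, an embedded monomial in the others; the
-- powers of the first variable then move it to the right exponent.
∏-var : (α : Vec ℕ m) → ∏ (λ i → var i ↑ lookup α i) ≈ monomial α
∏-var []      [] = ≡.refl
∏-var (a ∷ α) β  = ≡.trans
  (⊗-cong {f = q ↑ a} (λ _ → ≡.refl) (λ γ → ≡.trans
    (embed-∏ (λ i → var (suc i) ↑ lookup α i) (λ i → var i ↑ lookup α i) (λ i → embed-var-↑ i (lookup α i)) γ)
    (embed-cong (∏-var α) γ)) β)
  (q↑-⊗-embed a α β)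

monomial-diagonal : (α : Vec ℕ m) → monomial α α ≡ 1ℚ
monomial-diagonal α with Vecₚ.≡-dec ℕ._≟_ α α
... | yes _  = ≡.refl
... | no α≢α = contradiction ≡.refl α≢α

monomial-off : {α β : Vec ℕ m} → α ≢ β → monomial α β ≡ 0ℚ
monomial-off {α = α} {β} α≢β with Vecₚ.≡-dec ℕ._≟_ α β
... | yes α≡β = contradiction α≡β α≢β
... | no _    = ≡.refl

lookup≤sum : (α : Vec ℕ m) → ∀ i → lookup α i ≤ Vec.sum α
lookup≤sum (a ∷ α) zero    = ℕₚ.m≤m+n a (Vec.sum α)
lookup≤sum (a ∷ α) (suc i) = ℕₚ.≤-trans (lookup≤sum α i) (ℕₚ.m≤n+m (Vec.sum α) a)

-- The powers of the variables are the monomials, of which only α = β is nonzero at β. The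
-- hypothesis is pointwise because the substituted tuple is assembled by concatenation.
⟦var⟧ : ∀ (f : PS m) {g : Vector (PS m) m} → (∀ i → g i ≡ var i) → f ⟦ g ⟧ ≈ f
⟦var⟧ {m} f {g} g≡var β = begin
  (f ⟦ g ⟧) β                                              ≡⟨ Σℚ.Σ-cong (box m (Vec.sum β)) (λ α → ≡.cong (f α *_) (power α)) ⟩
  Σℚ.Σ (λ α → f α * monomial α β) (box m (Vec.sum β))      ≡⟨ Σℚ.Σ-unique (Vecₚ.≡-dec ℕ._≟_) (λ α → f α * monomial α β)
                                                                (box-unique m (Vec.sum β)) (Listᴬ.[] ∷ [])
                                                                (λ {α} _ α∉ → ≡.trans (≡.cong (f α *_) (monomial-off (α∉ ∘ here))) (ℚₚ.*-zeroʳ (f α)))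
                                                                (λ { (here ≡.refl) β∉ → contradiction (∈-box⁺ β (lookup≤sum β)) β∉ }) ⟩
  f β * monomial β β + 0ℚ                                  ≡⟨ ℚₚ.+-identityʳ _ ⟩
  f β * monomial β β                                       ≡⟨ ≡.cong (f β *_) (monomial-diagonal β) ⟩
  f β * 1ℚ                                                 ≡⟨ ℚₚ.*-identityʳ (f β) ⟩
  f β                                                      ∎
  where
  open ≡-Reasoning
  open Truncated m (Vec.sum β) using (∏-cong; ≋-reflexive)
  power : ∀ α → ∏ (λ i → g i ↑ lookup α i) β ≡ monomial α β
  power α = ≡.trans (∏-cong (λ i → ≋-reflexive (≡.cong (_↑ lookup α i) (g≡var i))) .at β ℕₚ.≤-refl) (∏-var α β)

-- Makes T itself an instance of T⟨A , B⟩, so that the general expansion applies to it.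
T⟨X,Y⟩≈T : ∀ l → T⟨ X {l} , Y ⟩ ≈ T l
T⟨X,Y⟩≈T l = ⟦var⟧ (T l) variables
  where
  variables : ∀ i → (q F.∷ (X {l} F.++ Y)) i ≡ var i
  variables zero    = ≡.refl
  variables (suc i) with splitAt l i in eq
  ... | inj₁ j = ≡.cong (var ∘ suc) (Finₚ.splitAt⁻¹-↑ˡ eq)
  ... | inj₂ j = ≡.cong (var ∘ suc) (Finₚ.splitAt⁻¹-↑ʳ eq)

-- Conjugation of partitions

suffixSums : Vec ℕ l → Vec ℕ l
suffixSums []      = []
suffixSums (x ∷ d) = (x ℕ.+ Vec.sum d) ∷ suffixSums d

-- The sum v₁ + ... + vⱼ counts the parts that are at least uⱼ, so these are the part sizes of the
-- conjugate partition in increasing order. The argument `a` accumulates the entries already passed.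
prefixSums : ℕ → Vec ℕ l → Vec ℕ l
prefixSums a []      = []
prefixSums a (x ∷ v) = (a ℕ.+ x) ∷ prefixSums (a ℕ.+ x) v

sum-∷ʳ : ∀ (d : Vec ℕ l) x → Vec.sum (d ∷ʳ x) ≡ Vec.sum d ℕ.+ x
sum-∷ʳ []      x = ℕₚ.+-identityʳ x
sum-∷ʳ (y ∷ d) x = ≡.trans (≡.cong (y ℕ.+_) (sum-∷ʳ d x)) (≡.sym (ℕₚ.+-assoc y (Vec.sum d) x))

suffixSums-∷ʳ : ∀ (d : Vec ℕ l) x → suffixSums (d ∷ʳ x) ≡ Vec.map (ℕ._+ x) (suffixSums d) ∷ʳ x
suffixSums-∷ʳ []      x = ≡.cong (_∷ []) (ℕₚ.+-identityʳ x)
suffixSums-∷ʳ (y ∷ d) x = ≡.cong₂ _∷_ (≡.trans (≡.cong (y ℕ.+_) (sum-∷ʳ d x)) (≡.sym (ℕₚ.+-assoc y (Vec.sum d) x)))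
  (suffixSums-∷ʳ d x)

map-suffixSums-reverse : ∀ a (v : Vec ℕ l) → Vec.map (a ℕ.+_) (suffixSums (reverse v)) ≡ reverse (prefixSums a v)
map-suffixSums-reverse a []      = ≡.refl
map-suffixSums-reverse a (x ∷ v) = begin
  Vec.map (a ℕ.+_) (suffixSums (reverse (x ∷ v)))
    ≡⟨ ≡.cong (Vec.map (a ℕ.+_) ∘ suffixSums) (Vecₚ.reverse-∷ x v) ⟩
  Vec.map (a ℕ.+_) (suffixSums (reverse v ∷ʳ x))
    ≡⟨ ≡.cong (Vec.map (a ℕ.+_)) (suffixSums-∷ʳ (reverse v) x) ⟩
  Vec.map (a ℕ.+_) (Vec.map (ℕ._+ x) (suffixSums (reverse v)) ∷ʳ x)
    ≡⟨ Vecₚ.map-∷ʳ (a ℕ.+_) x _ ⟩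
  Vec.map (a ℕ.+_) (Vec.map (ℕ._+ x) (suffixSums (reverse v))) ∷ʳ (a ℕ.+ x)
    ≡⟨ ≡.cong (_∷ʳ (a ℕ.+ x)) (Vecₚ.map-∘ (a ℕ.+_) (ℕ._+ x) (suffixSums (reverse v))) ⟨
  Vec.map (λ s → a ℕ.+ (s ℕ.+ x)) (suffixSums (reverse v)) ∷ʳ (a ℕ.+ x)
    ≡⟨ ≡.cong (_∷ʳ (a ℕ.+ x)) (Vecₚ.map-cong (λ s → rearrange a s x) (suffixSums (reverse v))) ⟩
  Vec.map ((a ℕ.+ x) ℕ.+_) (suffixSums (reverse v)) ∷ʳ (a ℕ.+ x)
    ≡⟨ ≡.cong (_∷ʳ (a ℕ.+ x)) (map-suffixSums-reverse (a ℕ.+ x) v) ⟩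
  reverse (prefixSums (a ℕ.+ x) v) ∷ʳ (a ℕ.+ x)
    ≡⟨ Vecₚ.reverse-∷ (a ℕ.+ x) (prefixSums (a ℕ.+ x) v) ⟨
  reverse (prefixSums a (x ∷ v)) ∎
  where
  open ≡-Reasoning
  rearrange : ∀ a s x → a ℕ.+ (s ℕ.+ x) ≡ (a ℕ.+ x) ℕ.+ s
  rearrange = ℕSolver.solve-∀

suffixSums-reverse : (v : Vec ℕ l) → suffixSums (reverse v) ≡ reverse (prefixSums 0 v)
suffixSums-reverse v = ≡.trans (≡.sym (Vecₚ.map-id _)) (map-suffixSums-reverse 0 v)

∙-∷ʳ : ∀ (u v : Vec ℕ l) x y → (u ∷ʳ x) ∙ (v ∷ʳ y) ≡ u ∙ v ℕ.+ x ℕ.* y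
∙-∷ʳ []      []      x y = ℕₚ.+-identityʳ (x ℕ.* y)
∙-∷ʳ (a ∷ u) (b ∷ v) x y = ≡.trans (≡.cong (a ℕ.* b ℕ.+_) (∙-∷ʳ u v x y)) (≡.sym (ℕₚ.+-assoc (a ℕ.* b) (u ∙ v) (x ℕ.* y)))

∙-reverse : (u v : Vec ℕ l) → reverse u ∙ reverse v ≡ u ∙ v
∙-reverse []      []      = ≡.refl
∙-reverse (x ∷ u) (y ∷ v) = begin
  reverse (x ∷ u) ∙ reverse (y ∷ v)            ≡⟨ ≡.cong₂ _∙_ (Vecₚ.reverse-∷ x u) (Vecₚ.reverse-∷ y v) ⟩
  (reverse u ∷ʳ x) ∙ (reverse v ∷ʳ y)          ≡⟨ ∙-∷ʳ (reverse u) (reverse v) x y ⟩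
  reverse u ∙ reverse v ℕ.+ x ℕ.* y            ≡⟨ ≡.cong (ℕ._+ x ℕ.* y) (∙-reverse u v) ⟩
  u ∙ v ℕ.+ x ℕ.* y                            ≡⟨ ℕₚ.+-comm (u ∙ v) (x ℕ.* y) ⟩
  (x ∷ u) ∙ (y ∷ v)                            ∎
  where open ≡-Reasoning

-- Both sides count the cells of one Ferrers diagram, by columns and by rows; the accumulator adds
-- `a` rows of full width d₁ + ... + dₗ.
prefixSums-∙ : ∀ a (v d : Vec ℕ l) → prefixSums a v ∙ d ≡ a ℕ.* Vec.sum d ℕ.+ suffixSums d ∙ v
prefixSums-∙ a []      []      = ≡.sym (≡.trans (ℕₚ.+-identityʳ (a ℕ.* 0)) (ℕₚ.*-zeroʳ a))
prefixSums-∙ a (x ∷ v) (y ∷ d) = ≡.trans (≡.cong ((a ℕ.+ x) ℕ.* y ℕ.+_) (prefixSums-∙ (a ℕ.+ x) v d))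
  (rearrange a x y (Vec.sum d) (suffixSums d ∙ v))
  where
  rearrange : ∀ a x y s t → (a ℕ.+ x) ℕ.* y ℕ.+ ((a ℕ.+ x) ℕ.* s ℕ.+ t) ≡ a ℕ.* (y ℕ.+ s) ℕ.+ ((y ℕ.+ s) ℕ.* x ℕ.+ t)
  rearrange = ℕSolver.solve-∀

∙-conjugate : (d v : Vec ℕ l) → suffixSums d ∙ v ≡ suffixSums (reverse v) ∙ reverse d
∙-conjugate d v = begin
  suffixSums d ∙ v                      ≡⟨ prefixSums-∙ 0 v d ⟨
  prefixSums 0 v ∙ d                    ≡⟨ ∙-reverse (prefixSums 0 v) d ⟨
  reverse (prefixSums 0 v) ∙ reverse d  ≡⟨ ≡.cong (_∙ reverse d) (suffixSums-reverse v) ⟨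
  suffixSums (reverse v) ∙ reverse d    ∎
  where open ≡-Reasoning

suffixSums-injective : (d e : Vec ℕ l) → suffixSums d ≡ suffixSums e → d ≡ e
suffixSums-injective []      []      _  = ≡.refl
suffixSums-injective (x ∷ d) (y ∷ e) eq with suffixSums-injective d e (Vecₚ.∷-injectiveʳ eq)
... | ≡.refl = ≡.cong (_∷ d) (ℕₚ.+-cancelʳ-≡ (Vec.sum d) x y (Vecₚ.∷-injectiveˡ eq))

suffixSums-decreasing : (d : Vec ℕ l) → Positive d → Decreasing⁺ (suffixSums d)
suffixSums-decreasing []          []       = [] , []
suffixSums-decreasing (x ∷ [])    (p ∷ []) = [-] , ℕₚ.≤-trans p (ℕₚ.m≤m+n x 0) ∷ []
suffixSums-decreasing (x ∷ y ∷ d) (p ∷ pd) =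
  let linked , positive = suffixSums-decreasing (y ∷ d) pd in
  ℕₚ.+-monoˡ-≤ (y ℕ.+ Vec.sum d) p ∷ linked , ℕₚ.≤-trans p (ℕₚ.m≤m+n x _) ∷ positive

differences : (u : Vec ℕ l) → Decreasing⁺ u → ∃[ d ] Positive d × suffixSums d ≡ u
differences []          _                              = [] , [] , ≡.refl
differences (x ∷ [])    (_ , p ∷ [])                   = x ∷ [] , p ∷ [] , ≡.cong (_∷ []) (ℕₚ.+-identityʳ x)
differences (x ∷ y ∷ u) (x>y ∷ linked , _ ∷ positive)
  with d , pd , eq ← differences (y ∷ u) (linked , positive) =
    (x ∸ y) ∷ d , ℕₚ.m<n⇒0<n∸m x>y ∷ pd ,
    -- The differences already found add up to y, so the new first suffix sum is (x - y) + y = x.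
    ≡.cong₂ _∷_ (≡.trans (≡.cong (x ∸ y ℕ.+_) (sum≡head d eq)) (ℕₚ.m∸n+n≡m (ℕₚ.<⇒≤ x>y))) eq
  where
  sum≡head : ∀ {l y} {u : Vec ℕ l} (d : Vec ℕ (suc l)) → suffixSums d ≡ y ∷ u → Vec.sum d ≡ y
  sum≡head (_ ∷ _) eq = Vecₚ.∷-injectiveˡ eq

lookup≤suffixSums : (d : Vec ℕ l) → ∀ i → lookup d i ≤ lookup (suffixSums d) i
lookup≤suffixSums (x ∷ d) zero    = ℕₚ.m≤m+n x (Vec.sum d)
lookup≤suffixSums (x ∷ d) (suc i) = lookup≤suffixSums d i

All-reverse : ∀ {P : ℕ → Set} {v : Vec ℕ l} → All P v → All P (reverse v)
All-reverse []                     = []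
All-reverse {v = x ∷ v} (px ∷ pv) = ≡.subst (All _) (≡.sym (Vecₚ.reverse-∷ x v)) (All-∷ʳ (All-reverse pv) px)
  where
  All-∷ʳ : ∀ {n} {P : ℕ → Set} {v : Vec ℕ n} {x} → All P v → P x → All P (v ∷ʳ x)
  All-∷ʳ []        px = px ∷ []
  All-∷ʳ (py ∷ pv) px = py ∷ All-∷ʳ pv px

-- Summation by parts for linear forms

open NatSolver ℚ-semiring using (solve; _:=_; _:+_; _:*_)

lin-cong : (w : Vec ℕ l) {C D : Vector (PS m) l} → (∀ i → C i ≈ D i) → lin w C ≈ lin w D
lin-cong []      p α = ≡.refl
lin-cong (x ∷ w) p α = ≡.cong₂ (λ c s → ⟨ x ⟩ * c + s) (p zero α) (lin-cong w (p ∘ suc) α)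

lin-∷ʳ : ∀ (w : Vec ℕ l) x (C : Vector (PS m) (suc l)) →
         lin (w ∷ʳ x) C ≈ lin w (C ∘ inject₁) ⊕ x • C (fromℕ l)
lin-∷ʳ []      x C α = ℚₚ.+-comm (⟨ x ⟩ * C zero α) 0ℚ
lin-∷ʳ {suc l} (y ∷ w) x C α = ≡.trans (≡.cong (λ s → ⟨ y ⟩ * C zero α + s) (lin-∷ʳ w x (C ∘ suc) α))
  (≡.sym (ℚₚ.+-assoc (⟨ y ⟩ * C zero α) _ _))

opposite-fromℕ : ∀ n → opposite (fromℕ n) ≡ zero
opposite-fromℕ zero    = ≡.refl
opposite-fromℕ (suc n) = ≡.cong inject₁ (opposite-fromℕ n)

opposite-inject₁ : (i : Fin n) → opposite (inject₁ i) ≡ suc (opposite i)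
opposite-inject₁ {suc n} zero    = ≡.refl
opposite-inject₁ {suc n} (suc i) = ≡.cong inject₁ (opposite-inject₁ i)

lin-reverse : (w : Vec ℕ l) (C : Vector (PS m) l) → lin (reverse w) (C ∘ opposite) ≈ lin w C
lin-reverse []      C α = ≡.refl
lin-reverse {suc l} (x ∷ w) C α = begin
  lin (reverse (x ∷ w)) (C ∘ opposite) α
    ≡⟨ ≡.cong (λ z → lin z (C ∘ opposite) α) (Vecₚ.reverse-∷ x w) ⟩
  lin (reverse w ∷ʳ x) (C ∘ opposite) α
    ≡⟨ lin-∷ʳ (reverse w) x (C ∘ opposite) α ⟩
  lin (reverse w) (C ∘ opposite ∘ inject₁) α + ⟨ x ⟩ * C (opposite (fromℕ l)) α
    ≡⟨ ≡.cong₂ (λ s i → s + ⟨ x ⟩ * C i α)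
         (lin-cong (reverse w) (λ i β → ≡.cong (λ k → C k β) (opposite-inject₁ i)) α) (opposite-fromℕ l) ⟩
  lin (reverse w) (C ∘ suc ∘ opposite) α + ⟨ x ⟩ * C zero α
    ≡⟨ ≡.cong (_+ ⟨ x ⟩ * C zero α) (lin-reverse w (C ∘ suc) α) ⟩
  lin w (C ∘ suc) α + ⟨ x ⟩ * C zero α
    ≡⟨ ℚₚ.+-comm (lin w (C ∘ suc) α) _ ⟩
  lin (x ∷ w) C α ∎
  where open ≡-Reasoning

lin-shift : ∀ (d : Vec ℕ l) (f : PS m) (C : Vector (PS m) l) →
            lin d (λ i → f ⊕ C i) ≈ Vec.sum d • f ⊕ lin d C
lin-shift []      f C α = ≡.sym (≡.trans (ℚₚ.+-identityʳ _) (ℚₚ.*-zeroˡ (f α)))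
lin-shift (x ∷ d) f C α = begin
  ⟨ x ⟩ * (f α + C zero α) + lin d (λ i → f ⊕ C (suc i)) α
    ≡⟨ ≡.cong (λ s → ⟨ x ⟩ * (f α + C zero α) + s) (lin-shift d f (C ∘ suc) α) ⟩
  ⟨ x ⟩ * (f α + C zero α) + (⟨ Vec.sum d ⟩ * f α + lin d (C ∘ suc) α)
    ≡⟨ solve 5 (λ x a b s t → x :* (a :+ b) :+ (s :* a :+ t) := (x :+ s) :* a :+ (x :* b :+ t)) ≡.refl
         ⟨ x ⟩ (f α) (C zero α) ⟨ Vec.sum d ⟩ (lin d (C ∘ suc) α) ⟩
  (⟨ x ⟩ + ⟨ Vec.sum d ⟩) * f α + lin (x ∷ d) C α
    ≡⟨ ≡.cong (λ c → c * f α + lin (x ∷ d) C α) (⟨⟩-+ x (Vec.sum d)) ⟨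
  ⟨ Vec.sum (x ∷ d) ⟩ * f α + lin (x ∷ d) C α ∎
  where open ≡-Reasoning

-- Exchange of summation: dᵢ occurs in exactly the first i suffix sums and so collects C₁ + ... +
-- Cᵢ.
lin-suffixSums : (d : Vec ℕ l) (C : Vector (PS m) l) → lin (suffixSums d) C ≈ lin d (partialSum C)
lin-suffixSums []      C α = ≡.refl
lin-suffixSums (x ∷ d) C α = begin
  ⟨ x ℕ.+ Vec.sum d ⟩ * C zero α + lin (suffixSums d) (C ∘ suc) α
    ≡⟨ ≡.cong₂ (λ c s → c * C zero α + s) (⟨⟩-+ x (Vec.sum d)) (lin-suffixSums d (C ∘ suc) α) ⟩
  (⟨ x ⟩ + ⟨ Vec.sum d ⟩) * C zero α + lin d (partialSum (C ∘ suc)) α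
    ≡⟨ solve 4 (λ x s a t → (x :+ s) :* a :+ t := x :* a :+ (s :* a :+ t)) ≡.refl
         ⟨ x ⟩ ⟨ Vec.sum d ⟩ (C zero α) (lin d (partialSum (C ∘ suc)) α) ⟩
  ⟨ x ⟩ * C zero α + (⟨ Vec.sum d ⟩ * C zero α + lin d (partialSum (C ∘ suc)) α)
    ≡⟨ ≡.cong (λ s → ⟨ x ⟩ * C zero α + s) (lin-shift d (C zero) (partialSum (C ∘ suc)) α) ⟨
  lin (x ∷ d) (partialSum C) α ∎
  where open ≡-Reasoning

-- The entry vⱼ occurs in the prefix sums from the jth on, where the differences telescope to Cⱼ
-- thanks to the final zero. The accumulator occurs in all of them and collects C₁, written
-- `snoc C 0ₛ zero` so that it is zero for an empty vector.
lin-prefixSums : ∀ a (v : Vec ℕ l) (C : Vector (PS m) l) →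
  lin (prefixSums a v) (λ i → C i ⊖ snoc C 0ₛ (suc i)) ≈ a • snoc C 0ₛ zero ⊕ lin v C
lin-prefixSums a []      C α = ≡.sym (≡.trans (ℚₚ.+-identityʳ _) (ℚₚ.*-zeroʳ ⟨ a ⟩))
lin-prefixSums a (x ∷ v) C α = begin
  c * (C zero α + (- s)) + lin (prefixSums (a ℕ.+ x) v) (λ i → C (suc i) ⊖ snoc (C ∘ suc) 0ₛ (suc i)) α
    ≡⟨ ≡.cong (λ z → c * (C zero α + (- s)) + z) (lin-prefixSums (a ℕ.+ x) v (C ∘ suc) α) ⟩
  c * (C zero α + (- s)) + (c * s + t)
    ≡⟨ solve 5 (λ c y z s t → c :* (y :+ z) :+ (c :* s :+ t) := c :* (y :+ (z :+ s)) :+ t) ≡.refl c (C zero α) (- s) s t ⟩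
  c * (C zero α + ((- s) + s)) + t
    ≡⟨ ≡.cong (λ z → c * z + t) (≡.trans (≡.cong (λ z → C zero α + z) (ℚₚ.+-inverseˡ s)) (ℚₚ.+-identityʳ (C zero α))) ⟩
  c * C zero α + t
    ≡⟨ ≡.cong (λ z → z * C zero α + t) (⟨⟩-+ a x) ⟩
  (⟨ a ⟩ + ⟨ x ⟩) * C zero α + t
    ≡⟨ solve 4 (λ a x y t → (a :+ x) :* y :+ t := a :* y :+ (x :* y :+ t)) ≡.refl ⟨ a ⟩ ⟨ x ⟩ (C zero α) t ⟩
  ⟨ a ⟩ * C zero α + lin (x ∷ v) C α ∎
  where
  open ≡-Reasoning
  c s t : ℚ
  c = ⟨ a ℕ.+ x ⟩
  s = snoc (C ∘ suc) 0ₛ zero α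
  t = lin v (C ∘ suc) α

-- The form attached to the parts u becomes one attached to the multiplicities `reverse d` of the
-- conjugate; this is the origin of the partial sums of Y. In the same way `lin-X′` produces the
-- differences of X.
lin-Y′ : (d : Vec ℕ l) → lin (suffixSums d) Y ≈ lin (reverse d) (Y′ {l})
lin-Y′ d α = ≡.trans (lin-suffixSums d Y α) (≡.sym (lin-reverse d (partialSum Y) α))

lin-X′ : (v : Vec ℕ l) → lin v X ≈ lin (suffixSums (reverse v)) (X′ {l})
lin-X′ {l} v α = begin
  lin v X α                                       ≡⟨ ℚₚ.+-identityˡ (lin v X α) ⟨
  -- Inserts the accumulator term of `lin-prefixSums`, whose coefficient is 0 here.
  0ℚ + lin v X α                                  ≡⟨ ≡.cong (_+ lin v X α) (ℚₚ.*-zeroˡ (X⁺ {l} zero α)) ⟨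
  0ℚ * X⁺ {l} zero α + lin v X α               ≡⟨ lin-prefixSums 0 v X α ⟨
  lin (prefixSums 0 v) D α                        ≡⟨ lin-reverse (prefixSums 0 v) D α ⟨
  lin (reverse (prefixSums 0 v)) (D ∘ opposite) α ≡⟨ ≡.cong (λ w → lin w (X′ {l}) α) (suffixSums-reverse v) ⟨
  lin (suffixSums (reverse v)) X′ α               ∎
  where
  open ≡-Reasoning
  D : Vector (Series l) l
  D i = X i ⊖ X⁺ (suc i)

-- The partition relation and the theorem

Ord-snoc : {f : Vector (PS m) n} → (∀ j → Ord 1 (f j)) → ∀ i → Ord 1 (snoc f 0ₛ i)
Ord-snoc {n = zero}  o _       α _ = ≡.refl
Ord-snoc {n = suc n} o zero    = o zero
Ord-snoc {n = suc n} o (suc i) = Ord-snoc (o ∘ suc) i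

Ord-partialSum : {f : Vector (PS m) n} → (∀ j → Ord 1 (f j)) → ∀ i → Ord 1 (partialSum f i)
Ord-partialSum o zero    = o zero
Ord-partialSum {f = f} o (suc i) = Ord-⊕ {f = f zero} (o zero) (Ord-partialSum (o ∘ suc) i)

Ord-X : ∀ j → Ord 1 (X {l} j)
Ord-X {l} j = Ord-var (suc (j ↑ˡ l))

Ord-Y : ∀ j → Ord 1 (Y {l} j)
Ord-Y {l} j = Ord-var (suc (l ↑ʳ j))

Ord-X′ : ∀ j → Ord 1 (X′ {l} j)
Ord-X′ {l} j = Ord-⊖ {f = X (opposite j)} {X⁺ (suc (opposite j))} (Ord-X (opposite j)) (Ord-snoc (Ord-X {l}) (suc (opposite j)))

Ord-Y′ : ∀ j → Ord 1 (Y′ {l} j)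
Ord-Y′ {l} j = Ord-partialSum (Ord-Y {l}) (opposite j)

-- Both sides become sums over one list of pairs (d , v) of positive vectors, read through `φ` as a
-- partition and through `ψ` as its conjugate. Conjugation need not preserve any enumeration of the
-- (u , v) themselves, whereas in these coordinates it only reverses and swaps.
T⟨X,Y⟩≈[]T⟨Y′,X′⟩ : ∀ l M → T⟨ X {l} , Y ⟩ ≈[ M ] T⟨ Y′ {l} , X′ ⟩
T⟨X,Y⟩≈[]T⟨Y′,X′⟩ l M = begin
  T⟨ X {l} , Y ⟩
    ≈⟨ T⟨⟩-exhaust (Ord-X {l}) (Ord-Y {l}) (Uniqueₚ.map⁺ φ-injective pairs-unique) φ-index φ-covers ⟩
  Σ (W X Y) (List.map φ pairs)
    ≡⟨ Σ-map (W X Y) φ pairs ⟩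
  Σ (W X Y ∘ φ) pairs
    ≈⟨ Σ-cong pairs W-conjugate ⟩
  Σ (W Y′ X′ ∘ ψ) pairs
    ≡⟨ Σ-map (W Y′ X′) ψ pairs ⟨
  Σ (W Y′ X′) (List.map ψ pairs)
    ≈⟨ T⟨⟩-exhaust (Ord-Y′ {l}) (Ord-X′ {l}) (Uniqueₚ.map⁺ ψ-injective pairs-unique) ψ-index ψ-covers ⟨
  T⟨ Y′ {l} , X′ ⟩ ∎
  where
  open Truncated (suc (l ℕ.+ l)) M
  open import Relation.Binary.Reasoning.Setoid ≋-setoid

  pairs : List (Vec ℕ l × Vec ℕ l)
  pairs = cartesianProduct (posBox l M) (posBox l M)

  pairs-unique : Unique pairs
  pairs-unique = Uniqueₚ.cartesianProduct⁺ (posBox-unique l M) (posBox-unique l M)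

  φ ψ : Vec ℕ l × Vec ℕ l → Vec ℕ l × Vec ℕ l
  φ (d , v) = suffixSums d , v
  -- The conjugate has the parts v₁ + ... + vⱼ with multiplicities dⱼ; reversal lists the parts in
  -- decreasing order.
  ψ (d , v) = suffixSums (reverse v) , reverse d

  φ-injective : ∀ {x y} → φ x ≡ φ y → x ≡ y
  φ-injective eq = ≡.cong₂ _,_ (suffixSums-injective _ _ (Productₚ.,-injectiveˡ eq)) (Productₚ.,-injectiveʳ eq)

  ψ-injective : ∀ {x y} → ψ x ≡ ψ y → x ≡ y
  ψ-injective eq = ≡.cong₂ _,_ (Vecₚ.reverse-injective (Productₚ.,-injectiveʳ eq))
    (Vecₚ.reverse-injective (suffixSums-injective _ _ (Productₚ.,-injectiveˡ eq)))

  φ-index : ∀ {uv} → uv ∈ List.map φ pairs → Index uv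
  φ-index uv∈ with (d , v) , dv∈ , ≡.refl ← ∈-map⁻ φ uv∈ =
    let d∈ , v∈ = ∈-cartesianProduct⁻ (posBox l M) (posBox l M) dv∈ in
    suffixSums-decreasing d (∈-posBox⁻ d∈) , ∈-posBox⁻ v∈

  ψ-index : ∀ {uv} → uv ∈ List.map ψ pairs → Index uv
  ψ-index uv∈ with (d , v) , dv∈ , ≡.refl ← ∈-map⁻ ψ uv∈ =
    let d∈ , v∈ = ∈-cartesianProduct⁻ (posBox l M) (posBox l M) dv∈ in
    suffixSums-decreasing (reverse v) (All-reverse (∈-posBox⁻ v∈)) , All-reverse (∈-posBox⁻ d∈)

  bounds : ∀ {d v : Vec ℕ l} → Positive d → Positive v → suffixSums d ∙ v ≤ M → All (_≤ M) d × All (_≤ M) v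
  bounds {d} {v} pd pv w≤M =
    Vecᴬₚ.lookup⁻ (λ i → ℕₚ.≤-trans (lookup≤suffixSums d i) (ℕₚ.≤-trans (lookup≤∙ˡ (suffixSums d) v pv i) w≤M)) ,
    Vecᴬₚ.lookup⁻ (λ i → ℕₚ.≤-trans (lookup≤∙ʳ (suffixSums d) v (proj₂ (suffixSums-decreasing d pd)) i) w≤M)

  ∈-pairs : ∀ {d v} → Positive d → Positive v → All (_≤ M) d → All (_≤ M) v → (d , v) ∈ pairs
  ∈-pairs pd pv d≤M v≤M = ∈-cartesianProduct⁺ (∈-posBox⁺ pd (Vecᴬₚ.lookup⁺ d≤M)) (∈-posBox⁺ pv (Vecᴬₚ.lookup⁺ v≤M))

  φ-covers : ∀ {uv} → Index uv → weight uv ≤ M → uv ∈ List.map φ pairs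
  φ-covers {u , v} (du , pv) w≤M with d , pd , ≡.refl ← differences u du =
    let d≤M , v≤M = bounds pd pv w≤M in ∈-map⁺ φ (∈-pairs pd pv d≤M v≤M)

  ψ-covers : ∀ {uv} → Index uv → weight uv ≤ M → uv ∈ List.map ψ pairs
  ψ-covers {u , v} (du , pv) w≤M with d , pd , ≡.refl ← differences u du =
    let d≤M , v≤M = bounds pd pv w≤M in
    -- Conjugation is an involution in these coordinates: the preimage of (suffixSums d , v) under
    -- `ψ` is (reverse v , reverse d).
    ≡.subst (_∈ List.map ψ pairs)
      (≡.cong₂ _,_ (≡.cong suffixSums (Vecₚ.reverse-involutive d)) (Vecₚ.reverse-involutive v))
      (∈-map⁺ ψ (∈-pairs (All-reverse pv) (All-reverse pd) (All-reverse v≤M) (All-reverse d≤M)))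

  W-conjugate : ∀ dv → W X Y (φ dv) ≋ W Y′ X′ (ψ dv)
  W-conjugate (d , v) = ⊗-cong≋
    (≋-reflexive (≡.cong (q ↑_) (∙-conjugate d v)))
    -- Parts and multiplicities exchange roles, so the two exponentials have to change places before
    -- they are compared.
    (≋-trans (⊗-comm (exp (lin (suffixSums d) Y)) (exp (lin v X))) (⊗-cong≋
      (exp-cong (Ord-lin v Ord-X) (Ord-lin (suffixSums (reverse v)) Ord-X′) (≈⇒≈[] (lin-X′ v)))
      (exp-cong (Ord-lin (suffixSums d) Ord-Y) (Ord-lin (reverse d) Ord-Y′) (≈⇒≈[] (lin-Y′ d)))))

partition-relation : ∀ l → T l ≈ T⟨ Y′ {l} , X′ ⟩
partition-relation l α = ≡.trans (≡.sym (T⟨X,Y⟩≈T l α)) (T⟨X,Y⟩≈[]T⟨Y′,X′⟩ l (Vec.sum α) .at α ℕₚ.≤-refl)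

IsSum-resp-≈ : ∀ {I : Set} {P : I → Set} {f : I → PS m} {s t : PS m} → s ≈ t → IsSum P f s → IsSum P f t
IsSum-resp-≈ s≈t isSum α =
  let S , unique , all , vanish , total = isSum α in S , unique , all , vanish , ≡.trans total (s≈t α)

theorem2p3 : (l : ℕ) → l ≥ 1 →
    IsSum Decreasing⁺ (λ (u : Vec ℕ l) → ∏ (λ j → E (lookup u j) (Y j) ⊗ L (lookup u j) (X j))) (T l)
    × IsSum Decreasing⁺ (λ (u : Vec ℕ l) → ∏ (λ j → E (lookup u j) (X′ j) ⊗ L (lookup u j) (Y′ j))) (T l)
    × T l ≈ T⟨ Y′ {l} , X′ ⟩
theorem2p3 l _ =
  IsSum-resp-≈ (T⟨X,Y⟩≈T l) (T⟨⟩-isSum (Ord-X {l}) (Ord-Y {l})) ,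
  -- The expansion gives the second sum for T at the changed variables, which the partition relation
  -- identifies with T.
  IsSum-resp-≈ (λ α → ≡.sym (partition-relation l α)) (T⟨⟩-isSum (Ord-Y′ {l}) (Ord-X′ {l})) ,
  partition-relation l
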